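{- Let $G$ be a $2$-connected $[4,2]$-graph of order $n\ge 7$. Then $G$ contains a pancyclic edge, i.e., an edge $e$ such that for every integer $k$ with $3\le k\le n$, $e$ lies in a cycle of length $k$ in $G$.
   Context: All graphs are finite and simple. For a positive integer $s$ and a nonnegative integer $t$, a graph $G$ of order at least $s$ is called an $[s,t]$-graph if every induced subgraph of $G$ on $s$ vertices has at least $t$ edges. A $k$-cycle is a cycle of length $k$. -}

module Defs where

open import Data.Nat using (ℕ; zero; suc; _+_; _≤_; _∸_)
open import Data.Fin using (Fin; toℕ)
open import Data.Bool using (Bool; true; false; if_then_else_)
open import Data.Product using (Σ; _×_; _,_; ∃)
open import Data.Sum using (_⊎_)
open import Relation.Binary.PropositionalEquality using (_≡_; _≢_)
open import Function.Definitions using (Injective)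

record Graph (n : ℕ) : Set where
  field
    adj   : Fin n → Fin n → Bool
    sym   : ∀ x y → adj x y ≡ adj y x
    irrfl : ∀ x → adj x x ≡ false

open Graph public

Adj : ∀ {n} → Graph n → Fin n → Fin n → Set
Adj G x y = adj G x y ≡ true

b2n : Bool → ℕ
b2n true  = 1
b2n false = 0

edges4 : ∀ {n} → Graph n → Fin n → Fin n → Fin n → Fin n → ℕ
edges4 G a b c d =
  b2n (adj G a b) + b2n (adj G a c) + b2n (adj G a d)
  + b2n (adj G b c) + b2n (adj G b d) + b2n (adj G c d)

Is42Graph : ∀ {n} → Graph n → Set
Is42Graph {n} G = 4 ≤ n ×
  (∀ a b c d → a ≢ b → a ≢ c → a ≢ d → b ≢ c → b ≢ d → c ≢ d →
     2 ≤ edges4 G a b c d)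

data Walk {n} (G : Graph n) (ok : Fin n → Set) : Fin n → Fin n → Set where
  here : ∀ {x} → ok x → Walk G ok x x
  step : ∀ {x y z} → ok x → Adj G x y → Walk G ok y z → Walk G ok x z

AllV : ∀ {n} → Fin n → Set
AllV _ = Data.Unit.⊤
  where import Data.Unit

Connected : ∀ {n} → Graph n → Set
Connected G = ∀ x y → Walk G AllV x y

ConnectedWithout : ∀ {n} → Graph n → Fin n → Set
ConnectedWithout G v = ∀ x y → x ≢ v → y ≢ v → Walk G (λ z → z ≢ v) x y

TwoConnected : ∀ {n} → Graph n → Set
TwoConnected {n} G = 3 ≤ n × Connected G × (∀ v → ConnectedWithout G v)

Consec : ∀ {k} → Fin k → Fin k → Set
Consec {k} i j = suc (toℕ i) ≡ toℕ j ⊎ (suc (toℕ i) ≡ k × toℕ j ≡ 0)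

IsCycle : ∀ {n} → Graph n → (k : ℕ) → (Fin k → Fin n) → Set
IsCycle G k f = 3 ≤ k × Injective _≡_ _≡_ f ×
  (∀ i j → Consec i j → Adj G (f i) (f j))

EdgeOnCycle : ∀ {n} → Graph n → Fin n → Fin n → ℕ → Set
EdgeOnCycle {n} G u v k = Σ (Fin k → Fin n) λ f → IsCycle G k f ×
  Σ (Fin k) λ i → Σ (Fin k) λ j → Consec i j ×
    ((f i ≡ u × f j ≡ v) ⊎ (f i ≡ v × f j ≡ u))

PancyclicEdge : ∀ {n} → Graph n → Fin n → Fin n → Set
PancyclicEdge {n} G u v = Adj G u v ×
  (∀ k → 3 ≤ k → k ≤ n → EdgeOnCycle G u v k)

{-# OPTIONS --safe #-}

-- A cycle through an edge uv is a path from u to v, and in a [4,2]-graph no four vertices span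
-- five non-edges.  Let d be a vertex off a cycle through uv of length at least seven, with two or
-- more neighbours on it.  If they are not exactly u and v, the cycle can be rerouted through d
-- without losing uv: when no obvious rerouting exists, d and the successors of its neighbours are
-- independent, so every other vertex is joined to almost all of them.  If they are exactly u and v,
-- the remaining vertices are complete up to a matching and another edge takes over from uv.
--
-- The vertices of a 7-cycle carry an edge lying in cycles of all lengths 3, …, 7 (a finite check), so
-- it suffices to find a 7-cycle from which all vertices are reached by successively adding vertices
-- with two neighbours in the set obtained so far.  A 4-cycle always exists, and it grows to a
-- longer cycle.  If a cycle with at least five vertices cannot be grown, 2-connectivity gives two
-- disjoint edges leaving it; the graph is then nearly a union of two cliques, and every other vertex
-- has two neighbours on a 7-cycle through both edges.

module Submission where

open import Defs hiding (sym)
open import Data.Bool using (true; false)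
import Data.Bool as Bool
open import Data.Nat using (ℕ; zero; suc; pred; _+_; _≤_; _<_; s≤s)
import Data.Nat.Properties as ℕ
open import Data.Fin using (Fin; zero; suc; toℕ; inject≤)
import Data.Fin.Properties as Fin
open import Data.Fin.Properties using (_≟_; any?; all?; injective⇒≤; inject≤-injective)
open import Data.Fin.Patterns
open import Data.Product using (Σ; _×_; _,_; proj₁; proj₂; ∃)
open import Data.Product.Properties using (≡-dec)
open import Data.Sum using (_⊎_; inj₁; inj₂)
open import Data.Empty using (⊥; ⊥-elim)
open import Data.List using (List; []; _∷_; _++_; length; map; lookup; allFin; tabulate)
import Data.List.Properties as List
open import Data.List.Membership.Propositional using (_∈_; _∉_)
open import Data.List.Membership.Propositional.Properties using (∈-++⁺ˡ; ∈-++⁺ʳ; ∈-++⁻; ∈-∃++; ∈-allFin; ∈-lookup)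
import Data.List.Membership.DecPropositional as DecMembership
open import Data.List.Relation.Unary.All as All using (All; []; _∷_)
import Data.List.Relation.Unary.All.Properties as All
open import Data.List.Relation.Unary.Any as Any using (here; there)
import Data.List.Relation.Unary.Any.Properties as Any
open import Data.List.Relation.Unary.AllPairs using ([]; _∷_)
open import Data.List.Relation.Unary.Unique.Propositional using (Unique)
import Data.List.Relation.Unary.Unique.Propositional.Properties as Unique
open import Data.List.Relation.Binary.Permutation.Propositional using (_↭_; ↭-refl; ↭-sym; ↭-trans; ↭-reflexive; prep; swap)
open import Data.List.Relation.Binary.Permutation.Propositional.Properties using (++-commutativeMonoid; ++⁺; All-resp-↭; ∈-resp-↭; ↭-length; ↭-reverse; shift; map⁺)
open import Relation.Binary.PropositionalEquality using (_≡_; _≢_; refl; sym; trans; cong; subst)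
open import Relation.Nullary using (¬_; Dec; yes; no; contradiction; ¬?)
open import Relation.Nullary.Decidable using (_×-dec_; _⊎-dec_; _→-dec_; toWitness)
open import Function using (_∘_; case_of_)
import Algebra.Solver.CommutativeMonoid as CMSolver

-- Lists without repetition, up to permutation

private variable X : Set

-- Concatenation is a commutative monoid up to permutation, so reordering the blocks of a path is
-- left to the monoid solver.
module Reorder {X : Set} = CMSolver (++-commutativeMonoid {A = X})

Unique-resp-↭ : {xs ys : List X} → xs ↭ ys → Unique xs → Unique ys
Unique-resp-↭ _↭_.refl u = u
Unique-resp-↭ (prep x p) (x∉ ∷ u) = All-resp-↭ p x∉ ∷ Unique-resp-↭ p u
Unique-resp-↭ (_↭_.swap x y p) ((x≢y ∷ x∉) ∷ y∉ ∷ u) =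
  ((x≢y ∘ sym) ∷ All-resp-↭ p y∉) ∷ All-resp-↭ p x∉ ∷ Unique-resp-↭ p u
Unique-resp-↭ (_↭_.trans p q) u = Unique-resp-↭ q (Unique-resp-↭ p u)

Unique-++⁻ʳ : (xs : List X) {ys : List X} → Unique (xs ++ ys) → Unique ys
Unique-++⁻ʳ []       u       = u
Unique-++⁻ʳ (_ ∷ xs) (_ ∷ u) = Unique-++⁻ʳ xs u

Unique-++⁻ˡ : (xs : List X) {ys : List X} → Unique (xs ++ ys) → Unique xs
Unique-++⁻ˡ []       _        = []
Unique-++⁻ˡ (x ∷ xs) (x∉ ∷ u) = All.++⁻ˡ xs x∉ ∷ Unique-++⁻ˡ xs u

Unique-++⁻-apart : {xs ys : List X} {x y : X} → Unique (xs ++ ys) → x ∈ xs → y ∈ ys → x ≢ y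
Unique-++⁻-apart {xs = _ ∷ xs} (x∉ ∷ _) (here refl) y∈ = All.lookup x∉ (∈-++⁺ʳ xs y∈)
Unique-++⁻-apart (_ ∷ u)  (there x∈)  y∈ = Unique-++⁻-apart u x∈ y∈

extract : {x : X} {ys : List X} → x ∈ ys → ∃ λ zs → ys ↭ x ∷ zs
extract x∈ with as , bs , refl ← ∈-∃++ x∈ = as ++ bs , shift _ as bs

-- A pigeonhole principle, by induction on `xs`: when the head is taken out of both lists, it does
-- not recur in `xs`, so the inclusion survives, and the length bound drops by one on each side.
Unique-⊆⇒↭ : {xs ys : List X} → Unique xs → (∀ {x} → x ∈ xs → x ∈ ys) → length ys ≤ length xs → xs ↭ ys
Unique-⊆⇒↭ {xs = []} {[]} _ _ _ = ↭-refl
Unique-⊆⇒↭ {xs = x ∷ xs} {ys} (x∉ ∷ u) sub len with extract (sub (here refl))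
... | zs , σ = ↭-trans (prep x (Unique-⊆⇒↭ u sub′ (ℕ.≤-pred (subst (_≤ _) (↭-length σ) len)))) (↭-sym σ)
  where
  sub′ : ∀ {z} → z ∈ xs → z ∈ zs
  sub′ z∈ with ∈-resp-↭ σ (sub (there z∈))
  ... | here refl = contradiction refl (All.lookup x∉ z∈)
  ... | there z∈′ = z∈′

lookup-injective : {xs : List X} → Unique xs → ∀ {i j} → lookup xs i ≡ lookup xs j → i ≡ j
lookup-injective (_ ∷ _)  {zero}  {zero}  _  = refl
lookup-injective {xs = _ ∷ xs} (x∉ ∷ _) {zero} {suc j} eq = contradiction eq (All.lookup x∉ (∈-lookup j))
lookup-injective {xs = _ ∷ xs} (x∉ ∷ _) {suc i} {zero} eq = contradiction (sym eq) (All.lookup x∉ (∈-lookup i))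
lookup-injective (_ ∷ u)  {suc i} {suc j} eq = cong suc (lookup-injective u eq)

-- For paths found on positions: distinct positions, as many as `xs` has entries, exhaust `xs`, so
-- such a path is spanning.
map-lookup-↭ : (xs : List X) {is : List (Fin (length xs))} → Unique is → length is ≡ length xs →
               map (lookup xs) is ↭ xs
map-lookup-↭ xs u len =
  ↭-trans (map⁺ (lookup xs) (Unique-⊆⇒↭ u (λ {i} _ → ∈-allFin i)
            (ℕ.≤-reflexive (trans (List.length-tabulate _) (sym len)))))
          (↭-reflexive (trans (List.map-tabulate _ (lookup xs)) (List.tabulate-lookup xs)))

-- Paths and reroutings

module Paths {n : ℕ} (G : Graph n) where

  V : Set
  V = Fin n

  infix 4 _~_ _≁_ _~?_

  _~_ _≁_ : V → V → Set
  x ~ y = Adj G x y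
  x ≁ y = ¬ x ~ y

  _~?_ : ∀ x y → Dec (x ~ y)
  x ~? y = adj G x y Bool.≟ true

  ~-sym : ∀ {x y} → x ~ y → y ~ x
  ~-sym {x} {y} e = trans (Graph.sym G y x) e

  ~⇒≢ : ∀ {x y} → x ~ y → x ≢ y
  ~⇒≢ {x} e refl = case trans (sym e) (irrfl G x) of λ ()

  data Path : V → List V → V → Set where
    [_] : ∀ v → Path v (v ∷ []) v
    _∷_ : ∀ {u w v xs} → u ~ w → Path w xs v → Path u (u ∷ xs) v

  -- M matters only up to permutation, so reversing a path does not change it.
  Span : V → List V → V → Set
  Span u M v = Σ (List V) λ xs → Path u xs v × xs ↭ M

  first∈ : ∀ {u xs v} → Path u xs v → u ∈ xs
  first∈ [ _ ]   = here refl
  first∈ (_ ∷ _) = here refl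

  last∈ : ∀ {u xs v} → Path u xs v → v ∈ xs
  last∈ [ _ ]   = here refl
  last∈ (_ ∷ p) = there (last∈ p)

  infixr 5 _─⟨_⟩─_ _─⟨_⟩ₚ_ _─Front⟨_⟩─_

  _─⟨_⟩ₚ_ : ∀ {u xs v w ys z} → Path u xs v → v ~ w → Path w ys z → Path u (xs ++ ys) z
  [ _ ]   ─⟨ e ⟩ₚ q = e ∷ q
  (f ∷ p) ─⟨ e ⟩ₚ q = f ∷ (p ─⟨ e ⟩ₚ q)

  _─⟨_⟩─_ : ∀ {u M v w N z} → Span u M v → v ~ w → Span w N z → Span u (M ++ N) z
  (_ , p , σ) ─⟨ e ⟩─ (_ , q , τ) = _ , (p ─⟨ e ⟩ₚ q) , ++⁺ σ τ

  span : ∀ {u xs v} → Path u xs v → Span u xs v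
  span p = _ , p , ↭-refl

  pt : ∀ v → Span v (v ∷ []) v
  pt v = span [ v ]

  rearrange : ∀ {u M N v} → M ↭ N → Span u M v → Span u N v
  rearrange τ (_ , p , σ) = _ , p , ↭-trans σ τ

  open Reorder using (solve; _⊜_; _⊕_)

  reversed : ∀ {u xs v} → Path u xs v → Span v xs u
  reversed [ v ] = pt v
  reversed (_∷_ {u} {xs = xs} e p) =
    rearrange (solve 2 (λ a b → a ⊕ b ⊜ b ⊕ a) ↭-refl xs (u ∷ [])) (reversed p ─⟨ ~-sym e ⟩─ pt u)

  reverseSpan : ∀ {u M v} → Span u M v → Span v M u
  reverseSpan (_ , p , σ) = rearrange σ (reversed p)

  -- A path  u ⋯ x ─ a ⋯ y ─ b ⋯ v  absorbs a vertex adjacent to x and y once the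
  -- successors a and b are adjacent: the middle part is traversed backwards.
  crossSucc : ∀ {d u x a y b v L M N} → d ~ x → d ~ y → a ~ b →
              Span u L x → Span a M y → Span b N v → Span u (L ++ d ∷ M ++ N) v
  crossSucc {d} dx dy ab p q r = p ─⟨ ~-sym dx ⟩─ pt d ─⟨ dy ⟩─ reverseSpan q ─⟨ ab ⟩─ r

  -- The mirror image of `crossSucc`: now the predecessors `l` of `x` and `a` of `y` are adjacent,
  -- and the stretch from `x` to `a` is reversed.
  crossPred : ∀ {d u l x a y v L M N} → d ~ x → d ~ y → l ~ a →
              Span u L l → Span x M a → Span y N v → Span u (L ++ M ++ d ∷ N) v
  crossPred {d} dx dy la p q r = p ─⟨ la ⟩─ reverseSpan q ─⟨ ~-sym dx ⟩─ pt d ─⟨ dy ⟩─ r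

  Free : V → List V → Set
  Free d = All (d ≁_)

  -- What follows `y` on a path ending in `v`. The empty remainder needs its own constructor, since
  -- a `Path` has at least one vertex.
  data Rest (y : V) : List V → V → Set where
    end : Rest y [] y
    go  : ∀ {w R v} → y ~ w → Path w R v → Rest y R v

  -- Locates the first neighbour of `d` on a path: there is none, it is the initial vertex, or it
  -- follows a nonempty stretch free of neighbours of `d`.
  data Scan (d : V) : V → List V → V → Set where
    free  : ∀ {w M v} → Path w M v → Free d M → Scan d w M v
    now   : ∀ {w R v} → d ~ w → Rest w R v → Scan d w (w ∷ R) v
    later : ∀ {w A w′ y R v} → Path w A w′ → Free d A → w′ ~ y → d ~ y → Rest y R v →
            Scan d w (A ++ y ∷ R) v

  scan : ∀ d {w M v} → Path w M v → Scan d w M v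
  scan d [ v ] with d ~? v
  ... | yes dv = now dv end
  ... | no ¬dv = free [ v ] (¬dv ∷ [])
  scan d (_∷_ {w} e p) with d ~? w
  ... | yes dw = now dw (go e p)
  ... | no ¬dw with scan d p
  ...   | free q f         = free (e ∷ q) (¬dw ∷ f)
  ...   | now dy r         = later [ w ] (¬dw ∷ []) e dy r
  ...   | later q f e′ dy r = later (e ∷ q) (¬dw ∷ f) e′ dy r

  -- The counterpart of `Rest`: the possibly empty part of a path before `x`, without neighbours of
  -- `d`.
  data Front (d u x : V) : List V → Set where
    start : u ≡ x → Front d u x []
    after : ∀ {L l} → Path u L l → Free d L → l ~ x → Front d u x L

  _─Front⟨_⟩─_ : ∀ {d u x L w N v} → Front d u x L → x ~ w → Span w N v → Span u (L ++ x ∷ N) v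
  start refl      ─Front⟨ e ⟩─ q = pt _ ─⟨ e ⟩─ q
  after p _ e′ ─Front⟨ e ⟩─ q = span p ─⟨ e′ ⟩─ pt _ ─⟨ e ⟩─ q

  frontFree : ∀ {d u x L} → Front d u x L → Free d L
  frontFree (start _)     = []
  frontFree (after _ f _) = f

  frontSpan : ∀ {d u x L} → Front d u x L → Span u (L ++ x ∷ []) x
  frontSpan (start refl)  = pt _
  frontSpan (after p _ e) = span p ─⟨ e ⟩─ pt _

  -- What being a [4,2]-graph amounts to: four vertices never span five non-edges.
  FiveFree : Set
  FiveFree = ∀ {a b c d} → a ≢ b → a ≢ c → a ≢ d → b ≢ c → b ≢ d → c ≢ d →
             a ≁ b → a ≁ c → a ≁ d → b ≁ c → b ≁ d → ⊥

  is42⇒fiveFree : Is42Graph G → FiveFree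
  is42⇒fiveFree (_ , q) {a} {b} {c} {d} n₁ n₂ n₃ n₄ n₅ n₆ e₁ e₂ e₃ e₄ e₅
    with adj G a b | adj G a c | adj G a d | adj G b c | adj G b d | adj G c d
       | q a b c d n₁ n₂ n₃ n₄ n₅ n₆
  ... | true  | _ | _ | _ | _ | _ | _ = e₁ refl
  ... | false | true | _ | _ | _ | _ | _ = e₂ refl
  ... | false | false | true | _ | _ | _ | _ = e₃ refl
  ... | false | false | false | true | _ | _ | _ = e₄ refl
  ... | false | false | false | false | true | _ | _ = e₅ refl
  ... | false | false | false | false | false | true  | s≤s ()
  ... | false | false | false | false | false | false | ()

  -- Inserting a vertex into a path with fixed ends

  module Growing (five : FiveFree) where

    stable : ∀ {x y} → (x ≁ y → ⊥) → x ~ y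
    stable {x} {y} f with x ~? y
    ... | yes e = e
    ... | no ¬e = ⊥-elim (f ¬e)

    -- Four of the six pairs among `d`, `a`, `b`, `w` are non-edges already, so neither of the other
    -- two can be a fifth.
    joins : ∀ {d a b w} → d ≢ a → d ≢ b → a ≢ b → d ≢ w → w ≢ a → w ≢ b →
            d ≁ a → d ≁ b → a ≁ b → d ≁ w → w ~ a × w ~ b
    joins da db ab dw wa wb ¬da ¬db ¬ab ¬dw =
      stable (λ ¬wa → five da db dw ab (wa ∘ sym) (wb ∘ sym) ¬da ¬db ¬dw ¬ab (¬wa ∘ ~-sym)) ,
      stable (λ ¬wb → five db da dw (ab ∘ sym) (wb ∘ sym) (wa ∘ sym) ¬db ¬da ¬dw (¬ab ∘ ~-sym) (¬wb ∘ ~-sym))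

    -- The hypotheses on w hold when d, a, r are independent; they allow a rerouting as soon as
    -- one of L, A, R is long enough, and seven vertices leave a single exception.
    absorb₂′ : ∀ {d u x a a′ y r v L A R} → Front d u x L → d ~ x → x ~ a → Path a A a′ →
               Free d A → a′ ~ y → d ~ y → y ~ r → Path r R v → Free d R →
               Unique (d ∷ L ++ x ∷ A ++ y ∷ R) → 7 ≤ length (L ++ x ∷ A ++ y ∷ R) →
               (∀ {w} → w ∈ L → w ~ a × w ~ r) →
               (∀ {w} → w ∈ A → a ≢ w → w ~ a × w ~ r) →
               (∀ {w} → w ∈ R → r ≢ w → w ~ a × w ~ r) →
               Unique A → Unique R → Span u (d ∷ L ++ x ∷ A ++ y ∷ R) v
    -- `A` has at least three vertices: after `x`, `d`, `y` run backwards through `A` down to its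
    -- third vertex, jump to `a`, step to `a₂`, and jump to `r`.
    absorb₂′ {d} {x = x} {y = y} {L = L} {R = R} F dx xa (_∷_ {a} e₁ (_∷_ {a₂} {xs = A₃} e₂ p)) _ a′y dy yr q _ _ _
      _ touchA _ ((a≢a₂ ∷ a∉) ∷ _) _ =
      rearrange (solve 8 (λ l x d y b a c r → l ⊕ x ⊕ d ⊕ y ⊕ b ⊕ a ⊕ c ⊕ r ⊜ d ⊕ l ⊕ x ⊕ (a ⊕ c ⊕ b) ⊕ y ⊕ r) ↭-refl
                   L (x ∷ []) (d ∷ []) (y ∷ []) A₃ (a ∷ []) (a₂ ∷ []) R)
        (F ─Front⟨ ~-sym dx ⟩─ pt d ─⟨ dy ⟩─ pt y ─⟨ ~-sym a′y ⟩─ reversed p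
          ─⟨ proj₁ (touchA (there (there (first∈ p))) (All.lookup a∉ (first∈ p))) ⟩─ pt a
          ─⟨ e₁ ⟩─ pt a₂ ─⟨ proj₂ (touchA (there (here refl)) a≢a₂) ⟩─ span q)
    -- `R` has at least three vertices: after `x`, `d`, `y` run backwards through all of `A`, jump
    -- from `a` to `r₂`, step back to `r`, and jump to the third vertex of `R`.
    absorb₂′ {d} {x = x} {y = y} {L = L} {A = A} F dx xa p _ a′y dy yr (_∷_ {r} e₁ (_∷_ {r₂} {xs = R₃} e₂ q)) _ _ _
      _ _ touchR _ ((r≢r₂ ∷ r∉) ∷ _) =
      rearrange (solve 8 (λ l x d y a s r t → l ⊕ x ⊕ d ⊕ y ⊕ a ⊕ s ⊕ r ⊕ t ⊜ d ⊕ l ⊕ x ⊕ a ⊕ y ⊕ r ⊕ s ⊕ t) ↭-refl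
                   L (x ∷ []) (d ∷ []) (y ∷ []) A (r₂ ∷ []) (r ∷ []) R₃)
        (F ─Front⟨ ~-sym dx ⟩─ pt d ─⟨ dy ⟩─ pt y ─⟨ ~-sym a′y ⟩─ reversed p
          ─⟨ ~-sym (proj₁ (touchR (there (here refl)) r≢r₂)) ⟩─ pt r₂ ─⟨ ~-sym e₁ ⟩─ pt r
          ─⟨ ~-sym (proj₂ (touchR (there (there (first∈ q))) (All.lookup r∉ (first∈ q)))) ⟩─ span q)
    -- `L` has at least two vertices: jump from `u` to `a`, go on to `y`, `d`, `x`, return through
    -- `L` as far as the successor of `u`, and jump to `r`.
    absorb₂′ {d} {x = x} {y = y} {A = A} {R = R} (after (_∷_ {u} {xs = L} _ f) _ lx) dx xa p _ a′y dy yr q _ _ _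
      touchL _ _ _ _ =
      rearrange (solve 7 (λ u a y d x l r → u ⊕ a ⊕ y ⊕ d ⊕ x ⊕ l ⊕ r ⊜ d ⊕ u ⊕ l ⊕ x ⊕ a ⊕ y ⊕ r) ↭-refl
                   (u ∷ []) A (y ∷ []) (d ∷ []) (x ∷ []) L R)
        (pt u ─⟨ proj₁ (touchL (here refl)) ⟩─ span p ─⟨ a′y ⟩─ pt y ─⟨ ~-sym dy ⟩─ pt d ─⟨ dx ⟩─ pt x
          ─⟨ ~-sym lx ⟩─ reversed f ─⟨ proj₂ (touchL (there (first∈ f))) ⟩─ span q)
    -- The exception on seven vertices: `L` has one vertex, `A` and `R` have two each. An edge from
    -- `l` to `a₂` joins predecessors and allows a crossing; without it `d`, `l`, `a₂` are
    -- independent, and this forces the edge from `a₂` to `r₂`.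
    absorb₂′ {d} {x = x} {y = y} (after [ l ] (¬dl ∷ _) lx) dx xa (_∷_ {a} e₁ [ a₂ ]) (_ ∷ ¬da₂ ∷ _) a′y dy yr
      (_∷_ {r} e₂ [ r₂ ]) (_ ∷ ¬dr₂ ∷ _)
      ((dl ∷ _ ∷ _ ∷ da₂ ∷ _ ∷ _ ∷ dr₂ ∷ []) ∷ (_ ∷ _ ∷ la₂ ∷ _ ∷ _ ∷ lr₂ ∷ []) ∷ _ ∷ _ ∷ (_ ∷ _ ∷ a₂r₂ ∷ []) ∷ _) _
      touchL _ _ _ _ with l ~? a₂
    ... | yes la₂ = rearrange (solve 7 (λ l x a b d y r → l ⊕ (x ⊕ a ⊕ b) ⊕ d ⊕ y ⊕ r ⊜ d ⊕ l ⊕ x ⊕ (a ⊕ b) ⊕ y ⊕ r) ↭-refl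
                                 (l ∷ []) (x ∷ []) (a ∷ []) (a₂ ∷ []) (d ∷ []) (y ∷ []) (r ∷ r₂ ∷ []))
                      (crossPred dx dy la₂ (pt l) (span (xa ∷ e₁ ∷ [ a₂ ])) (span (yr ∷ e₂ ∷ [ r₂ ])))
    ... | no ¬la₂ = rearrange (solve 8 (λ l r y d x a b s → l ⊕ r ⊕ y ⊕ d ⊕ x ⊕ a ⊕ b ⊕ s ⊜ d ⊕ l ⊕ x ⊕ (a ⊕ b) ⊕ y ⊕ r ⊕ s) ↭-refl
                                 (l ∷ []) (r ∷ []) (y ∷ []) (d ∷ []) (x ∷ []) (a ∷ []) (a₂ ∷ []) (r₂ ∷ []))
                      (pt l ─⟨ proj₂ (touchL (here refl)) ⟩─ pt r ─⟨ ~-sym yr ⟩─ pt y ─⟨ ~-sym dy ⟩─ pt d ─⟨ dx ⟩─ pt x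
                        ─⟨ xa ⟩─ pt a ─⟨ e₁ ⟩─ pt a₂
                        ─⟨ ~-sym (proj₂ (joins dl da₂ la₂ dr₂ (lr₂ ∘ sym) (a₂r₂ ∘ sym) ¬dl ¬da₂ ¬la₂ ¬dr₂)) ⟩─ pt r₂)
    absorb₂′ (start _) _ _ [ _ ] _ _ _ _ [ _ ] _ _ (s≤s (s≤s (s≤s (s≤s ())))) _ _ _ _ _
    absorb₂′ (start _) _ _ [ _ ] _ _ _ _ (_ ∷ [ _ ]) _ _ (s≤s (s≤s (s≤s (s≤s (s≤s ()))))) _ _ _ _ _
    absorb₂′ (start _) _ _ (_ ∷ [ _ ]) _ _ _ _ [ _ ] _ _ (s≤s (s≤s (s≤s (s≤s (s≤s ()))))) _ _ _ _ _
    absorb₂′ (start _) _ _ (_ ∷ [ _ ]) _ _ _ _ (_ ∷ [ _ ]) _ _ (s≤s (s≤s (s≤s (s≤s (s≤s (s≤s ())))))) _ _ _ _ _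
    absorb₂′ (after [ _ ] _ _) _ _ [ _ ] _ _ _ _ [ _ ] _ _ (s≤s (s≤s (s≤s (s≤s (s≤s ()))))) _ _ _ _ _
    absorb₂′ (after [ _ ] _ _) _ _ [ _ ] _ _ _ _ (_ ∷ [ _ ]) _ _ (s≤s (s≤s (s≤s (s≤s (s≤s (s≤s ())))))) _ _ _ _ _
    absorb₂′ (after [ _ ] _ _) _ _ (_ ∷ [ _ ]) _ _ _ _ [ _ ] _ _ (s≤s (s≤s (s≤s (s≤s (s≤s (s≤s ())))))) _ _ _ _ _

    -- Either the successors `a` of `x` and `r` of `y` are adjacent and `crossSucc` applies, or `d`,
    -- `a`, `r` are independent and `joins` links every other vertex of `L`, `A`, `R` to both `a`
    -- and `r`.
    absorb₂ : ∀ {d u x a a′ y r v L A R} → Front d u x L → d ~ x → x ~ a → Path a A a′ →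
              Free d A → a′ ~ y → d ~ y → y ~ r → Path r R v → Free d R →
              Unique (d ∷ L ++ x ∷ A ++ y ∷ R) → 7 ≤ length (L ++ x ∷ A ++ y ∷ R) →
              Span u (d ∷ L ++ x ∷ A ++ y ∷ R) v
    absorb₂ {d} {x = x} {a} {y = y} {r} {L = L} {A} {R} F dx xa p ¬dA a′y dy yr q ¬dR U@(d∉ ∷ U′) len with a ~? r
    ... | yes ar = rearrange (solve 6 (λ d l x a y r → (l ⊕ x) ⊕ d ⊕ (a ⊕ y) ⊕ r ⊜ d ⊕ l ⊕ x ⊕ a ⊕ y ⊕ r) ↭-refl
                                (d ∷ []) L (x ∷ []) A (y ∷ []) R)
                     (crossSucc dx dy ar (frontSpan F) (span p ─⟨ a′y ⟩─ pt y) (span q))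
    ... | no ¬ar = absorb₂′ F dx xa p ¬dA a′y dy yr q ¬dR U len
                     (λ w∈ → touch (∈-++⁺ˡ w∈) (All.lookup (frontFree F) w∈)
                        (Unique-++⁻-apart U′ w∈ (there (∈-++⁺ˡ (first∈ p))))
                        (Unique-++⁻-apart U′ w∈ (there (∈-++⁺ʳ A (there (first∈ q))))))
                     (λ w∈ a≢w → touch (inA w∈) (All.lookup ¬dA w∈) (a≢w ∘ sym) (Unique-++⁻-apart UA w∈ (there (first∈ q))))
                     (λ w∈ r≢w → touch (inR w∈) (All.lookup ¬dR w∈) (Unique-++⁻-apart UA (first∈ p) (there w∈) ∘ sym) (r≢w ∘ sym))
                     (Unique-++⁻ˡ A UA) (Unique-++⁻ʳ (y ∷ []) (Unique-++⁻ʳ A UA))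
      where
      UA : Unique (A ++ y ∷ R)
      UA = Unique-++⁻ʳ (x ∷ []) (Unique-++⁻ʳ L U′)
      inA : ∀ {w} → w ∈ A → w ∈ L ++ x ∷ A ++ y ∷ R
      inA w∈ = ∈-++⁺ʳ L (there (∈-++⁺ˡ w∈))
      inR : ∀ {w} → w ∈ R → w ∈ L ++ x ∷ A ++ y ∷ R
      inR w∈ = ∈-++⁺ʳ L (there (∈-++⁺ʳ A (there w∈)))
      touch : ∀ {w} → w ∈ L ++ x ∷ A ++ y ∷ R → d ≁ w → w ≢ a → w ≢ r → w ~ a × w ~ r
      touch w∈ ¬dw w≢a w≢r =
        joins (All.lookup d∉ (inA (first∈ p))) (All.lookup d∉ (inR (first∈ q)))
          (Unique-++⁻-apart UA (first∈ p) (there (first∈ q))) (All.lookup d∉ w∈) w≢a w≢r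
          (All.lookup ¬dA (first∈ p)) (All.lookup ¬dR (first∈ q)) ¬ar ¬dw

    -- Both ends and one interior vertex are neighbours of `d`, so there are only two successors and
    -- two predecessors to cross. If the successors `a`, `b` are not adjacent, all further vertices
    -- of `A` and `B` are joined to both; this makes the predecessors adjacent or gives another
    -- detour.
    absorb₃ : ∀ {d u a a′ y b b′ v A B} → d ~ u → u ~ a → Path a A a′ → Free d A → a′ ~ y → d ~ y →
              y ~ b → Path b B b′ → Free d B → b′ ~ v → d ~ v →
              Unique (d ∷ u ∷ A ++ y ∷ B ++ v ∷ []) → 7 ≤ length (u ∷ A ++ y ∷ B ++ v ∷ []) →
              Span u (d ∷ u ∷ A ++ y ∷ B ++ v ∷ []) v
    absorb₃ {d} {u} {a} {a′} {y} {b} {b′} {v} {A} {B} du ua p ¬dA a′y dy yb q ¬dB b′v dv U@(d∉ ∷ _ ∷ UA) len with a ~? b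
    ... | yes ab = rearrange (solve 6 (λ d u a y b v → u ⊕ d ⊕ (a ⊕ y) ⊕ b ⊕ v ⊜ d ⊕ u ⊕ a ⊕ y ⊕ b ⊕ v) ↭-refl
                                (d ∷ []) (u ∷ []) A (y ∷ []) B (v ∷ []))
                     (crossSucc du dy ab (pt u) (span p ─⟨ a′y ⟩─ pt y) (span q ─⟨ b′v ⟩─ pt v))
    ... | no ¬ab = byCases p q refl refl
      where
      inA : ∀ {w} → w ∈ A → w ∈ u ∷ A ++ y ∷ B ++ v ∷ []
      inA w∈ = there (∈-++⁺ˡ w∈)
      inB : ∀ {w} → w ∈ B → w ∈ u ∷ A ++ y ∷ B ++ v ∷ []
      inB w∈ = there (∈-++⁺ʳ A (there (∈-++⁺ˡ w∈)))
      AB : ∀ {w z} → w ∈ A → z ∈ B → w ≢ z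
      AB w∈ z∈ = Unique-++⁻-apart UA w∈ (there (∈-++⁺ˡ z∈))
      touchA : ∀ {w} → w ∈ A → a ≢ w → w ~ a × w ~ b
      touchA w∈ a≢w =
        joins (All.lookup d∉ (inA (first∈ p))) (All.lookup d∉ (inB (first∈ q))) (AB (first∈ p) (first∈ q))
          (All.lookup d∉ (inA w∈)) (a≢w ∘ sym) (AB w∈ (first∈ q))
          (All.lookup ¬dA (first∈ p)) (All.lookup ¬dB (first∈ q)) ¬ab (All.lookup ¬dA w∈)
      touchB : ∀ {w} → w ∈ B → b ≢ w → w ~ a × w ~ b
      touchB w∈ b≢w =
        joins (All.lookup d∉ (inA (first∈ p))) (All.lookup d∉ (inB (first∈ q))) (AB (first∈ p) (first∈ q))
          (All.lookup d∉ (inB w∈)) (AB (first∈ p) w∈ ∘ sym) (b≢w ∘ sym)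
          (All.lookup ¬dA (first∈ p)) (All.lookup ¬dB (first∈ q)) ¬ab (All.lookup ¬dB w∈)
      viaPreds : a′ ~ b′ → Span u (d ∷ u ∷ A ++ y ∷ B ++ v ∷ []) v
      viaPreds a′b′ =
        rearrange (solve 6 (λ d u a y b v → (u ⊕ a) ⊕ (y ⊕ b) ⊕ d ⊕ v ⊜ d ⊕ u ⊕ a ⊕ y ⊕ b ⊕ v) ↭-refl
                     (d ∷ []) (u ∷ []) A (y ∷ []) B (v ∷ []))
          (crossPred dy dv a′b′ (pt u ─⟨ ua ⟩─ span p) (pt y ─⟨ yb ⟩─ span q) (pt v))
      byCases : ∀ {A′ B′} → Path a A′ a′ → Path b B′ b′ → A ≡ A′ → B ≡ B′ →
                Span u (d ∷ u ∷ A ++ y ∷ B ++ v ∷ []) v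
      byCases [ _ ] [ _ ] refl refl = case len of λ { (s≤s (s≤s (s≤s (s≤s (s≤s ()))))) }
      -- Here `a` is also the predecessor of `y`, and `b′` differs from `b`, hence is joined to `a`.
      byCases [ _ ] (_ ∷ q′) refl refl with Unique-++⁻ʳ (y ∷ []) (Unique-++⁻ʳ A UA)
      ... | b∉ ∷ _ = viaPreds (~-sym (proj₁ (touchB (there (last∈ q′)) (All.lookup b∉ (∈-++⁺ˡ (last∈ q′))))))
      byCases (_ ∷ p′) q′ refl refl with touchA (there (last∈ p′)) (All.lookup (headUnique UA) (∈-++⁺ˡ (last∈ p′)))
        where
        headUnique : ∀ {w ws} → Unique (w ∷ ws) → All (w ≢_) ws
        headUnique (w∉ ∷ _) = w∉
      byCases (_ ∷ p′) [ _ ] refl refl | _ , a′b = viaPreds a′b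
      -- Both stretches have at least two vertices: go through `u`, `d`, `y`, `b`, then backwards
      -- through `A` from `a′` to `a`, and jump to the second vertex of `B`.
      byCases (_ ∷ p′) (_∷_ {xs = B₂} _ q₂) refl refl | _ , a′b with Unique-++⁻ʳ (y ∷ []) (Unique-++⁻ʳ A UA)
      ... | b∉ ∷ _ =
        rearrange (solve 7 (λ u d y b a c v → u ⊕ d ⊕ y ⊕ b ⊕ a ⊕ c ⊕ v ⊜ d ⊕ u ⊕ a ⊕ y ⊕ (b ⊕ c) ⊕ v) ↭-refl
                     (u ∷ []) (d ∷ []) (y ∷ []) (b ∷ []) A B₂ (v ∷ []))
          (pt u ─⟨ ~-sym du ⟩─ pt d ─⟨ dy ⟩─ pt y ─⟨ yb ⟩─ pt b ─⟨ ~-sym a′b ⟩─ reversed p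
            ─⟨ ~-sym (proj₁ (touchB (there (first∈ q₂)) (All.lookup b∉ (∈-++⁺ˡ (first∈ q₂))))) ⟩─ span q₂ ─⟨ b′v ⟩─ pt v)

    -- `few` and `ends` are the only obstructions: at most one neighbour of `d` on the path, or
    -- exactly its two ends.
    data Growth (d u : V) : List V → V → Set where
      grown : ∀ {M v} → Span u (d ∷ M) v → Growth d u M v
      few   : ∀ {M v} x → (∀ {y} → y ∈ M → d ~ y → y ≡ x) → Growth d u M v
      ends  : ∀ {A a a′ v} → d ~ u → u ~ a → Path a A a′ → Free d A → a′ ~ v → d ~ v →
              Growth d u (u ∷ A ++ v ∷ []) v

    onlyAt : ∀ {d x y} L {R} → Free d L → Free d R → y ∈ L ++ x ∷ R → d ~ y → y ≡ x
    onlyAt L ¬dL ¬dR y∈ dy with ∈-++⁻ L y∈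
    ... | inj₁ y∈L         = contradiction dy (All.lookup ¬dL y∈L)
    ... | inj₂ (here y≡x)  = y≡x
    ... | inj₂ (there y∈R) = contradiction dy (All.lookup ¬dR y∈R)

    -- Three neighbours have three successors if the path continues after `z`, and three
    -- predecessors if it does not start at `x`. Such a triple either contains a neighbour of `d`,
    -- which then fits between `z` and `c`, or cannot be independent together with `d`, and an edge
    -- in it allows a crossing. When both ends are neighbours, `absorb₃` takes over.
    grow₃ : ∀ {d u x a a′ y b b′ z v L A B C} → Front d u x L → d ~ x → x ~ a → Path a A a′ → Free d A →
            a′ ~ y → d ~ y → y ~ b → Path b B b′ → Free d B → b′ ~ z → d ~ z → Rest z C v →
            Unique (d ∷ L ++ x ∷ A ++ y ∷ B ++ z ∷ C) → 7 ≤ length (L ++ x ∷ A ++ y ∷ B ++ z ∷ C) →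
            Span u (d ∷ L ++ x ∷ A ++ y ∷ B ++ z ∷ C) v
    grow₃ (start refl) dx xa p ¬dA a′y dy yb q ¬dB b′z dz end U len =
      absorb₃ dx xa p ¬dA a′y dy yb q ¬dB b′z dz U len
    grow₃ {d} {u} {x} {a} {a′} {y} {b} {b′} {z} {v} {L} {A} {B} (after {l = l} f ¬dL lx) dx xa p ¬dA a′y dy yb q ¬dB b′z dz end (d∉ ∷ U) _
      with l ~? a′ | l ~? b′ | a′ ~? b′
    ... | yes la′ | _ | _ =
      rearrange (solve 7 (λ d l x a y b z → l ⊕ (x ⊕ a) ⊕ d ⊕ y ⊕ b ⊕ z ⊜ d ⊕ l ⊕ x ⊕ a ⊕ y ⊕ b ⊕ z) ↭-refl
                   (d ∷ []) L (x ∷ []) A (y ∷ []) B (z ∷ []))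
        (crossPred dx dy la′ (span f) (pt x ─⟨ xa ⟩─ span p) (pt y ─⟨ yb ⟩─ span q ─⟨ b′z ⟩─ pt z))
    ... | no _ | yes lb′ | _ =
      rearrange (solve 7 (λ d l x a y b z → l ⊕ (x ⊕ a ⊕ y ⊕ b) ⊕ d ⊕ z ⊜ d ⊕ l ⊕ x ⊕ a ⊕ y ⊕ b ⊕ z) ↭-refl
                   (d ∷ []) L (x ∷ []) A (y ∷ []) B (z ∷ []))
        (crossPred dx dz lb′ (span f) (pt x ─⟨ xa ⟩─ span p ─⟨ a′y ⟩─ pt y ─⟨ yb ⟩─ span q) (pt z))
    ... | no _ | no _ | yes a′b′ =
      rearrange (solve 7 (λ d l x a y b z → (l ⊕ x ⊕ a) ⊕ (y ⊕ b) ⊕ d ⊕ z ⊜ d ⊕ l ⊕ x ⊕ a ⊕ y ⊕ b ⊕ z) ↭-refl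
                   (d ∷ []) L (x ∷ []) A (y ∷ []) B (z ∷ []))
        (crossPred dy dz a′b′ (span f ─⟨ lx ⟩─ pt x ─⟨ xa ⟩─ span p) (pt y ─⟨ yb ⟩─ span q) (pt z))
    ... | no ¬la′ | no ¬lb′ | no ¬a′b′ =
      ⊥-elim (five (All.lookup d∉ (∈-++⁺ˡ (last∈ f))) (All.lookup d∉ (∈-++⁺ʳ L (there (∈-++⁺ˡ (last∈ p)))))
                (All.lookup d∉ (∈-++⁺ʳ L (there (∈-++⁺ʳ A (there (∈-++⁺ˡ (last∈ q)))))))
                (Unique-++⁻-apart U (last∈ f) (there (∈-++⁺ˡ (last∈ p))))
                (Unique-++⁻-apart U (last∈ f) (there (∈-++⁺ʳ A (there (∈-++⁺ˡ (last∈ q))))))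
                (Unique-++⁻-apart (Unique-++⁻ʳ (x ∷ []) (Unique-++⁻ʳ L U)) (last∈ p) (there (∈-++⁺ˡ (last∈ q))))
                (All.lookup ¬dL (last∈ f)) (All.lookup ¬dA (last∈ p)) (All.lookup ¬dB (last∈ q)) ¬la′ ¬lb′)
    grow₃ {d} {u} {x} {a} {a′} {y} {b} {b′} {z} {v} {L} {A} {B} {C} F dx xa p ¬dA a′y dy yb q ¬dB b′z dz (go {c} zc r) (d∉ ∷ U) _
      with d ~? c | a ~? b | a ~? c | b ~? c
    ... | yes dc | _ | _ | _ =
      rearrange (solve 8 (λ d l x a y b z c → l ⊕ x ⊕ a ⊕ y ⊕ b ⊕ z ⊕ d ⊕ c ⊜ d ⊕ l ⊕ x ⊕ a ⊕ y ⊕ b ⊕ z ⊕ c) ↭-refl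
                   (d ∷ []) L (x ∷ []) A (y ∷ []) B (z ∷ []) C)
        (F ─Front⟨ xa ⟩─ span p ─⟨ a′y ⟩─ pt y ─⟨ yb ⟩─ span q ─⟨ b′z ⟩─ pt z ─⟨ ~-sym dz ⟩─ pt d ─⟨ dc ⟩─ span r)
    ... | no _ | yes ab | _ | _ =
      rearrange (solve 8 (λ d l x a y b z c → (l ⊕ x) ⊕ d ⊕ (a ⊕ y) ⊕ b ⊕ z ⊕ c ⊜ d ⊕ l ⊕ x ⊕ a ⊕ y ⊕ b ⊕ z ⊕ c) ↭-refl
                   (d ∷ []) L (x ∷ []) A (y ∷ []) B (z ∷ []) C)
        (crossSucc dx dy ab (frontSpan F) (span p ─⟨ a′y ⟩─ pt y) (span q ─⟨ b′z ⟩─ pt z ─⟨ zc ⟩─ span r))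
    ... | no _ | no _ | yes ac | _ =
      rearrange (solve 8 (λ d l x a y b z c → (l ⊕ x) ⊕ d ⊕ (a ⊕ y ⊕ b ⊕ z) ⊕ c ⊜ d ⊕ l ⊕ x ⊕ a ⊕ y ⊕ b ⊕ z ⊕ c) ↭-refl
                   (d ∷ []) L (x ∷ []) A (y ∷ []) B (z ∷ []) C)
        (crossSucc dx dz ac (frontSpan F) (span p ─⟨ a′y ⟩─ pt y ─⟨ yb ⟩─ span q ─⟨ b′z ⟩─ pt z) (span r))
    ... | no _ | no _ | no _ | yes bc =
      rearrange (solve 8 (λ d l x a y b z c → (l ⊕ x ⊕ a ⊕ y) ⊕ d ⊕ (b ⊕ z) ⊕ c ⊜ d ⊕ l ⊕ x ⊕ a ⊕ y ⊕ b ⊕ z ⊕ c) ↭-refl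
                   (d ∷ []) L (x ∷ []) A (y ∷ []) B (z ∷ []) C)
        (crossSucc dy dz bc (F ─Front⟨ xa ⟩─ span p ─⟨ a′y ⟩─ pt y) (span q ─⟨ b′z ⟩─ pt z) (span r))
    ... | no ¬dc | no ¬ab | no ¬ac | no ¬bc =
      ⊥-elim (five (All.lookup d∉ (∈-++⁺ʳ L (there (∈-++⁺ˡ (first∈ p)))))
                (All.lookup d∉ (∈-++⁺ʳ L (there (∈-++⁺ʳ A (there (∈-++⁺ˡ (first∈ q)))))))
                (All.lookup d∉ (∈-++⁺ʳ L (there (∈-++⁺ʳ A (there (∈-++⁺ʳ B (there (first∈ r))))))))
                (Unique-++⁻-apart UA (first∈ p) (there (∈-++⁺ˡ (first∈ q))))
                (Unique-++⁻-apart UA (first∈ p) (there (∈-++⁺ʳ B (there (first∈ r)))))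
                (Unique-++⁻-apart (Unique-++⁻ʳ (y ∷ []) (Unique-++⁻ʳ A UA)) (first∈ q) (there (first∈ r)))
                (All.lookup ¬dA (first∈ p)) (All.lookup ¬dB (first∈ q)) ¬dc ¬ab ¬ac)
      where
      UA : Unique (A ++ y ∷ B ++ z ∷ C)
      UA = Unique-++⁻ʳ (x ∷ []) (Unique-++⁻ʳ L U)

    grow₂ : ∀ {d u x a a′ y v L A R} → Front d u x L → d ~ x → x ~ a → Path a A a′ → Free d A →
            a′ ~ y → d ~ y → Rest y R v →
            Unique (d ∷ L ++ x ∷ A ++ y ∷ R) → 7 ≤ length (L ++ x ∷ A ++ y ∷ R) → Growth d u (L ++ x ∷ A ++ y ∷ R) v
    grow₂ (start refl) dx xa p ¬dA a′y dy end _ _ = ends dx xa p ¬dA a′y dy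
    -- The last neighbour `y` has no successor; reversing the path turns the predecessors `a′` and
    -- `l` into successors.
    grow₂ {d} {x = x} {y = y} {L = L} {A} (after f ¬dL lx) dx xa p ¬dA a′y dy end U len
      with reversed p | reversed f
    ... | A′ , p′ , σ | L′ , f′ , τ =
      grown (rearrange (↭-sym π) (reverseSpan (absorb₂ (start refl) dy (~-sym a′y) p′ (All-resp-↭ (↭-sym σ) ¬dA) (~-sym xa) dx
        (~-sym lx) f′ (All-resp-↭ (↭-sym τ) ¬dL) (Unique-resp-↭ π U)
        (subst (7 ≤_) (cong pred (↭-length π)) len))))
      where
      π : d ∷ L ++ x ∷ A ++ y ∷ [] ↭ d ∷ y ∷ A′ ++ x ∷ L′
      π = ↭-trans (solve 5 (λ d l x a y → d ⊕ l ⊕ x ⊕ a ⊕ y ⊜ d ⊕ y ⊕ a ⊕ x ⊕ l) ↭-refl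
                     (d ∷ []) L (x ∷ []) A (y ∷ []))
            (prep d (prep y (++⁺ (↭-sym σ) (prep x (↭-sym τ)))))
    grow₂ {d} {x = x} {y = y} {L = L} {A} F dx xa p ¬dA a′y dy (go {R = R} yr q) U len with scan d q
    ... | free q′ ¬dR = grown (absorb₂ F dx xa p ¬dA a′y dy yr q′ ¬dR U len)
    ... | now dr _ = grown (rearrange (solve 6 (λ d l x a y r → l ⊕ x ⊕ a ⊕ y ⊕ d ⊕ r ⊜ d ⊕ l ⊕ x ⊕ a ⊕ y ⊕ r) ↭-refl
                                         (d ∷ []) L (x ∷ []) A (y ∷ []) R)
                             (F ─Front⟨ xa ⟩─ span p ─⟨ a′y ⟩─ pt y ─⟨ ~-sym dy ⟩─ pt d ─⟨ dr ⟩─ span q))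
    ... | later q′ ¬dB b′z dz r = grown (grow₃ F dx xa p ¬dA a′y dy yr q′ ¬dB b′z dz r U len)

    grow₁ : ∀ {d u x v L R} → Front d u x L → d ~ x → Rest x R v →
            Unique (d ∷ L ++ x ∷ R) → 7 ≤ length (L ++ x ∷ R) → Growth d u (L ++ x ∷ R) v
    grow₁ {x = x} {L = L} F dx end U len = few x (onlyAt L (frontFree F) [])
    grow₁ {d} {x = x} {L = L} F dx (go {R = R} xa p) U len with scan d p
    ... | free _ ¬dR = few x (onlyAt L (frontFree F) ¬dR)
    ... | now da _ = grown (rearrange (solve 4 (λ d l x r → l ⊕ x ⊕ d ⊕ r ⊜ d ⊕ l ⊕ x ⊕ r) ↭-refl
                                         (d ∷ []) L (x ∷ []) R)
                             (F ─Front⟨ ~-sym dx ⟩─ pt d ─⟨ da ⟩─ span p))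
    ... | later p′ ¬dA a′y dy r = grow₂ F dx xa p′ ¬dA a′y dy r U len

    grow : ∀ {d u v M} → Path u M v → Unique (d ∷ M) → 7 ≤ length M → Growth d u M v
    grow {d} {u} p U len with scan d p
    ... | free _ ¬dM         = few u λ y∈ dy → contradiction dy (All.lookup ¬dM y∈)
    ... | now du r           = grow₁ (start refl) du r U len
    ... | later f ¬dL lx dx r = grow₁ (after f ¬dL lx) dx r U len

-- Certified case analyses on few vertices

module _ {m : ℕ} where

  Pairs : Set
  Pairs = List (Fin m × Fin m)

  open DecMembership (≡-dec (_≟_ {m}) (_≟_ {m})) using () renaming (_∈?_ to _∈ₚ?_)
  open DecMembership (_≟_ {m}) using (_∈?_)

  Known : Pairs → Fin m → Fin m → Set
  Known L i j = (i , j) ∈ L ⊎ (j , i) ∈ L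

  known? : ∀ L i j → Dec (Known L i j)
  known? L i j = ((i , j) ∈ₚ? L) ⊎-dec ((j , i) ∈ₚ? L)

  -- A path with exactly `k` edges from `w` to `t`; `avoid` collects the vertices already passed.
  Reach : Pairs → Fin m → ℕ → Fin m → List (Fin m) → Set
  Reach E t zero    w avoid = w ≡ t
  Reach E t (suc k) w avoid = ∃ λ x → Known E w x × x ∉ w ∷ avoid × Reach E t k x (w ∷ avoid)

  reach? : ∀ E t k w avoid → Dec (Reach E t k w avoid)
  reach? E t zero    w avoid = w ≟ t
  reach? E t (suc k) w avoid =
    any? λ x → known? E w x ×-dec ¬? (x ∈? w ∷ avoid) ×-dec reach? E t k x (w ∷ avoid)

  -- The first subtree of  split i j  treats the case that i and j are not adjacent.
  data Cert : Set where
    split  : (i j : Fin m) → Cert → Cert → Cert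
    refute : (a b c d : Fin m) → Cert
    lone   : (h k : Fin m) → Cert
    cycles : (u v : Fin m) → Cert

  -- The path lengths ks count edges, so 2 stands for triangles.
  Valid : (busy : List (Fin m)) (ks : List ℕ) (E N : Pairs) → Cert → Set
  Valid busy ks E N (split i j s t)  = Valid busy ks E ((i , j) ∷ N) s × Valid busy ks ((i , j) ∷ E) N t
  Valid busy ks E N (refute a b c d) =
    (a ≢ b × a ≢ c × a ≢ d × b ≢ c × b ≢ d × c ≢ d) ×
    (Known N a b × Known N a c × Known N a d × Known N b c × Known N b d)
  -- A contradictory leaf: a busy vertex has two neighbours among the `m` vertices, but for `h` only
  -- `k` is left.
  Valid busy ks E N (lone h k)       = h ∈ busy × (∀ i → i ≢ h → i ≢ k → Known N h i)
  Valid busy ks E N (cycles u v)     = Known E u v × All (λ k → Reach E v k u []) ks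

  valid? : ∀ busy ks E N c → Dec (Valid busy ks E N c)
  valid? busy ks E N (split i j s t)  = valid? busy ks E ((i , j) ∷ N) s ×-dec valid? busy ks ((i , j) ∷ E) N t
  valid? busy ks E N (refute a b c d) =
    (¬? (a ≟ b) ×-dec ¬? (a ≟ c) ×-dec ¬? (a ≟ d) ×-dec ¬? (b ≟ c) ×-dec ¬? (b ≟ d) ×-dec ¬? (c ≟ d)) ×-dec
    (known? N a b ×-dec known? N a c ×-dec known? N a d ×-dec known? N b c ×-dec known? N b d)
  valid? busy ks E N (lone h k)       =
    (h ∈? busy) ×-dec all? λ i → ¬? (i ≟ h) →-dec (¬? (i ≟ k) →-dec known? N h i)
  valid? busy ks E N (cycles u v)     = known? E u v ×-dec All.all? (λ k → reach? E v k u []) ks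

  module Soundness {n : ℕ} (G : Graph n) (five : Paths.FiveFree G)
                   (ρ : Fin m → Fin n) (ρ-injective : ∀ {i j} → ρ i ≡ ρ j → i ≡ j) where

    open Paths G

    Edges NonEdges : Pairs → Set
    Edges    = All λ (i , j) → ρ i ~ ρ j
    NonEdges = All λ (i , j) → ρ i ≁ ρ j

    Busy : Fin m → Set
    Busy h = ∃ λ i → ∃ λ j → i ≢ j × ρ h ~ ρ i × ρ h ~ ρ j

    Joined : Fin m → Fin m → ℕ → Set
    Joined u v k = ∃ λ xs → Path (ρ u) (map ρ xs) (ρ v) × Unique xs × length xs ≡ suc k

    Found : List ℕ → Set
    Found ks = ∃ λ u → ∃ λ v → ρ u ~ ρ v × All (Joined u v) ks

    edge : ∀ {E i j} → Edges E → Known E i j → ρ i ~ ρ j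
    edge es (inj₁ ij∈) = All.lookup es ij∈
    edge es (inj₂ ji∈) = ~-sym (All.lookup es ji∈)

    nonEdge : ∀ {N i j} → NonEdges N → Known N i j → ρ i ≁ ρ j
    nonEdge ns (inj₁ ij∈) = All.lookup ns ij∈
    nonEdge ns (inj₂ ji∈) = All.lookup ns ji∈ ∘ ~-sym

    reach-sound : ∀ {E t} k {w avoid} → Edges E → Reach E t k w avoid → w ∉ avoid →
                  ∃ λ xs → Path (ρ w) (map ρ xs) (ρ t) × Unique xs × length xs ≡ suc k × All (_∉ avoid) xs
    reach-sound zero {w} es refl w∉ = w ∷ [] , [ ρ w ] , [] ∷ [] , refl , w∉ ∷ []
    reach-sound (suc k) {w} es (x , wx , x∉ , r) w∉ with reach-sound k es r x∉
    ... | xs , p , u , eq , out =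
      w ∷ xs , edge es wx ∷ p , All.map (λ z∉ w≡z → z∉ (here (sym w≡z))) out ∷ u , cong suc eq ,
      w∉ ∷ All.map (_∘ there) out

    -- The tree is followed according to the actual adjacencies in `G`. Leaves `refute` and `lone`
    -- cannot be reached this way, so the descent stops at a `cycles` leaf, whose edge and paths are
    -- carried over by `ρ`.
    sound : ∀ {busy ks E N} c → Valid busy ks E N c → All Busy busy → Edges E → NonEdges N → Found ks
    sound (split i j s t) (vs , vt) bs es ns with ρ i ~? ρ j
    ... | yes ij = sound t vt bs (ij ∷ es) ns
    ... | no ¬ij = sound s vs bs es (¬ij ∷ ns)
    sound (refute a b c d) ((ab , ac , ad , bc , bd , cd) , kab , kac , kad , kbc , kbd) bs es ns =
      ⊥-elim (five (ab ∘ ρ-injective) (ac ∘ ρ-injective) (ad ∘ ρ-injective)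
                (bc ∘ ρ-injective) (bd ∘ ρ-injective) (cd ∘ ρ-injective)
                (nonEdge ns kab) (nonEdge ns kac) (nonEdge ns kad) (nonEdge ns kbc) (nonEdge ns kbd))
    sound (lone h k) (h∈ , only) bs es ns with All.lookup bs h∈
    ... | i , j , i≢j , hi , hj with i ≟ k | j ≟ k
    ...   | yes refl | yes refl = contradiction refl i≢j
    ...   | no i≢k   | _        = contradiction hi (nonEdge ns (only i (λ { refl → ~⇒≢ hi refl }) i≢k))
    ...   | yes _    | no j≢k   = contradiction hj (nonEdge ns (only j (λ { refl → ~⇒≢ hj refl }) j≢k))
    sound (cycles u v) (uv , rs) bs es ns =
      u , v , edge es uv ,
      All.map (λ {k} r → let xs , p , uq , eq , _ = reach-sound k es r (λ ()) in xs , p , uq , eq) rs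

-- In pentagonCert and hexagonCert the last vertex is the one to be added to the cycle on the others.

pentagonCert : Cert {6}
pentagonCert =
  split 2F 5F (split 4F 5F (split 1F 5F (split 3F 5F (lone 5F 0F) (split 0F 5F (lone 5F 3F) (split 1F 4F
  (split 2F 4F (refute 4F 5F 1F 2F) (cycles 0F 1F)) (cycles 0F 4F)))) (split 0F 5F (split 3F 5F (lone 5F 1F)
  (split 2F 4F (split 0F 2F (refute 2F 5F 0F 4F) (cycles 0F 2F)) (cycles 0F 1F))) (cycles 0F 4F))) (split 3F
  5F (split 0F 5F (split 1F 5F (lone 5F 4F) (split 0F 2F (split 0F 3F (refute 0F 5F 2F 3F) (cycles 0F 3F))
  (cycles 0F 1F))) (cycles 0F 1F)) (cycles 0F 1F))) (split 1F 5F (split 3F 5F (split 4F 5F (split 0F 5F (lone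
  5F 2F) (split 1F 3F (split 1F 4F (refute 1F 5F 3F 4F) (cycles 0F 1F)) (cycles 0F 4F))) (split 1F 3F (split
  0F 5F (split 0F 3F (refute 3F 5F 0F 1F) (cycles 0F 1F)) (cycles 0F 1F)) (cycles 0F 1F))) (cycles 0F 1F))
  (cycles 0F 1F))

abstract
  pentagonValid : Valid (5F ∷ []) (5 ∷ []) ((0F , 1F) ∷ (1F , 2F) ∷ (2F , 3F) ∷ (3F , 4F) ∷ (4F , 0F) ∷ []) [] pentagonCert
  pentagonValid = toWitness {a? = valid? (5F ∷ []) (5 ∷ []) ((0F , 1F) ∷ (1F , 2F) ∷ (2F , 3F) ∷ (3F , 4F) ∷ (4F , 0F) ∷ []) [] pentagonCert} _

hexagonCert : Cert {7}
hexagonCert =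
  split 1F 6F (split 5F 6F (split 3F 6F (split 2F 6F (split 4F 6F (lone 6F 0F) (split 0F 6F (lone 6F 4F)
  (split 3F 5F (split 1F 5F (refute 5F 6F 1F 3F) (cycles 0F 5F)) (cycles 0F 1F)))) (split 0F 6F (split 4F 6F
  (lone 6F 2F) (split 3F 5F (split 1F 3F (refute 3F 6F 1F 5F) (cycles 0F 1F)) (cycles 0F 1F))) (split 1F 5F
  (split 1F 3F (refute 1F 6F 3F 5F) (cycles 0F 5F)) (cycles 0F 1F)))) (split 4F 6F (split 2F 6F (split 0F 6F
  (lone 6F 3F) (split 2F 5F (split 1F 4F (split 1F 5F (refute 5F 6F 1F 2F) (split 2F 4F (refute 4F 6F 1F 2F)
  (cycles 0F 1F))) (cycles 0F 5F)) (cycles 0F 1F))) (cycles 0F 1F)) (cycles 0F 1F))) (split 4F 6F (split 0F 6F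
  (split 2F 6F (split 3F 6F (lone 6F 5F) (split 2F 4F (split 0F 4F (refute 4F 6F 0F 2F) (cycles 0F 1F))
  (cycles 0F 1F))) (split 1F 4F (split 3F 6F (split 0F 3F (split 1F 3F (refute 3F 6F 0F 1F) (split 0F 4F
  (refute 0F 6F 3F 4F) (cycles 0F 1F))) (cycles 0F 1F)) (cycles 0F 1F)) (cycles 0F 1F))) (cycles 0F 1F))
  (cycles 0F 1F))) (split 0F 6F (split 2F 6F (split 4F 6F (split 3F 6F (split 5F 6F (lone 6F 1F) (split 0F 2F
  (split 0F 4F (refute 0F 6F 2F 4F) (cycles 0F 4F)) (cycles 0F 1F))) (split 2F 4F (split 0F 2F (refute 2F 6F
  0F 4F) (cycles 0F 2F)) (cycles 0F 1F))) (split 5F 6F (split 2F 5F (split 3F 6F (split 0F 3F (split 0F 2F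
  (refute 0F 6F 2F 3F) (split 3F 5F (refute 3F 6F 0F 5F) (cycles 0F 1F))) (cycles 0F 3F)) (cycles 0F 1F))
  (cycles 0F 1F)) (cycles 0F 1F))) (cycles 0F 1F)) (cycles 0F 5F))

abstract
  hexagonValid : Valid (6F ∷ []) (6 ∷ []) ((0F , 1F) ∷ (1F , 2F) ∷ (2F , 3F) ∷ (3F , 4F) ∷ (4F , 5F) ∷ (5F , 0F) ∷ []) [] hexagonCert
  hexagonValid = toWitness {a? = valid? (6F ∷ []) (6 ∷ []) ((0F , 1F) ∷ (1F , 2F) ∷ (2F , 3F) ∷ (3F , 4F) ∷ (4F , 5F) ∷ (5F , 0F) ∷ []) [] hexagonCert} _

-- Only the seven sides of the cycle are given. The edge named at a leaf may be a chord; paths with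
-- 2, ..., 6 edges between its ends close to cycles of lengths 3, ..., 7.
heptagonCert : Cert {7}
heptagonCert =
  split 2F 4F (split 0F 2F (split 0F 4F (split 4F 6F (split 2F 6F (refute 2F 4F 0F 6F) (split 0F 5F (split 2F
  5F (refute 0F 2F 4F 5F) (split 1F 3F (split 1F 5F (split 3F 5F (split 0F 3F (refute 3F 5F 0F 1F) (cycles 2F
  6F)) (cycles 2F 3F)) (split 1F 4F (split 1F 6F (split 3F 6F (refute 1F 6F 3F 4F) (cycles 1F 2F)) (cycles 1F
  2F)) (cycles 1F 4F))) (cycles 1F 2F))) (split 1F 3F (split 1F 6F (split 3F 6F (split 1F 4F (refute 1F 6F 3F
  4F) (cycles 0F 5F)) (cycles 0F 6F)) (cycles 0F 1F)) (cycles 0F 6F)))) (split 0F 5F (split 2F 5F (refute 0F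
  2F 4F 5F) (split 1F 3F (split 1F 5F (split 3F 5F (split 0F 3F (refute 3F 5F 0F 1F) (cycles 4F 5F)) (cycles
  2F 3F)) (cycles 1F 5F)) (cycles 2F 3F))) (split 1F 3F (split 1F 5F (split 1F 6F (split 3F 5F (split 3F 6F
  (refute 1F 3F 5F 6F) (cycles 0F 5F)) (cycles 0F 5F)) (cycles 0F 1F)) (cycles 0F 1F)) (cycles 0F 5F))))
  (split 3F 5F (split 0F 3F (split 0F 5F (split 2F 5F (refute 0F 5F 2F 3F) (split 1F 3F (split 1F 5F (refute
  3F 5F 0F 1F) (cycles 1F 5F)) (cycles 1F 3F))) (split 1F 6F (split 1F 3F (split 3F 6F (split 1F 5F (refute 1F
  3F 5F 6F) (cycles 0F 1F)) (cycles 4F 5F)) (cycles 4F 5F)) (cycles 0F 1F))) (split 1F 6F (split 1F 3F (split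
  3F 6F (split 1F 5F (refute 1F 3F 5F 6F) (cycles 0F 4F)) (split 1F 4F (split 2F 6F (split 4F 6F (refute 4F 6F
  1F 2F) (cycles 0F 4F)) (cycles 0F 3F)) (cycles 0F 1F))) (cycles 0F 1F)) (cycles 0F 1F))) (split 1F 4F (split
  1F 6F (split 4F 6F (split 2F 6F (refute 4F 6F 1F 2F) (cycles 3F 5F)) (cycles 0F 4F)) (cycles 0F 6F)) (cycles
  0F 4F)))) (split 1F 6F (split 1F 4F (split 4F 6F (split 2F 6F (refute 4F 6F 1F 2F) (split 1F 3F (split 3F 6F
  (refute 1F 6F 3F 4F) (cycles 0F 6F)) (cycles 0F 1F))) (split 1F 3F (split 1F 5F (split 3F 5F (split 3F 6F
  (refute 1F 3F 5F 6F) (cycles 3F 4F)) (cycles 3F 4F)) (cycles 0F 1F)) (cycles 0F 1F))) (split 1F 3F (split 1F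
  5F (split 3F 5F (split 3F 6F (refute 1F 3F 5F 6F) (cycles 0F 2F)) (cycles 1F 2F)) (cycles 0F 1F)) (cycles 0F
  1F))) (split 1F 3F (split 1F 5F (split 3F 5F (split 0F 3F (split 0F 5F (refute 3F 5F 0F 1F) (cycles 0F 2F))
  (cycles 0F 3F)) (cycles 0F 2F)) (cycles 0F 2F)) (cycles 0F 2F)))) (split 3F 5F (split 1F 3F (split 1F 5F
  (split 1F 6F (split 3F 6F (refute 1F 3F 5F 6F) (split 0F 3F (split 0F 5F (refute 3F 5F 0F 1F) (cycles 3F
  4F)) (cycles 0F 3F))) (split 0F 3F (split 0F 5F (refute 3F 5F 0F 1F) (cycles 0F 1F)) (cycles 0F 1F))) (split
  2F 5F (split 0F 2F (split 0F 3F (split 0F 5F (refute 0F 5F 2F 3F) (cycles 0F 1F)) (cycles 2F 3F)) (cycles 0F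
  1F)) (cycles 1F 2F))) (split 2F 5F (split 0F 2F (split 0F 3F (split 0F 5F (refute 0F 5F 2F 3F) (cycles 1F
  2F)) (cycles 0F 1F)) (cycles 0F 1F)) (cycles 1F 2F))) (split 1F 3F (split 1F 4F (split 1F 6F (split 3F 6F
  (split 4F 6F (refute 1F 6F 3F 4F) (cycles 2F 3F)) (cycles 2F 3F)) (cycles 2F 3F)) (cycles 1F 2F)) (cycles 1F
  2F)))

abstract
  heptagonValid : Valid [] (2 ∷ 3 ∷ 4 ∷ 5 ∷ 6 ∷ []) ((0F , 1F) ∷ (1F , 2F) ∷ (2F , 3F) ∷ (3F , 4F) ∷ (4F , 5F) ∷ (5F , 6F) ∷ (6F , 0F) ∷ []) [] heptagonCert
  heptagonValid = toWitness {a? = valid? [] (2 ∷ 3 ∷ 4 ∷ 5 ∷ 6 ∷ []) ((0F , 1F) ∷ (1F , 2F) ∷ (2F , 3F) ∷ (3F , 4F) ∷ (4F , 5F) ∷ (5F , 6F) ∷ (6F , 0F) ∷ []) [] heptagonCert} _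

-- A 4-cycle near a vertex with three neighbours; nothing is assumed about the other three vertices.
starCert : Cert {7}
starCert =
  split 2F 3F (split 3F 5F (split 3F 6F (split 3F 4F (split 2F 5F (split 2F 6F (refute 2F 3F 5F 6F) (split 1F
  6F (split 2F 4F (refute 2F 3F 4F 5F) (split 1F 4F (split 1F 3F (refute 1F 3F 4F 6F) (split 5F 6F (refute 3F
  5F 2F 6F) (split 4F 5F (refute 3F 5F 2F 4F) (cycles 2F 4F)))) (cycles 0F 1F))) (cycles 0F 1F))) (split 1F 5F
  (split 1F 3F (split 1F 4F (refute 1F 3F 4F 5F) (split 2F 4F (split 1F 2F (refute 2F 3F 1F 4F) (split 4F 5F
  (refute 3F 4F 2F 5F) (cycles 1F 2F))) (cycles 0F 1F))) (split 4F 6F (split 5F 6F (refute 3F 6F 4F 5F) (split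
  2F 4F (refute 3F 4F 2F 6F) (split 4F 5F (refute 3F 4F 5F 6F) (split 2F 6F (refute 3F 6F 2F 4F) (cycles 2F
  4F))))) (split 5F 6F (split 4F 5F (refute 3F 5F 4F 6F) (split 2F 6F (refute 3F 6F 2F 5F) (cycles 2F 5F)))
  (split 2F 4F (split 4F 5F (refute 3F 4F 2F 5F) (split 2F 6F (refute 2F 3F 4F 6F) (cycles 2F 5F))) (cycles 2F
  4F))))) (cycles 0F 1F))) (split 2F 4F (split 2F 5F (split 2F 6F (refute 2F 3F 5F 6F) (split 1F 6F (split 1F
  4F (split 1F 2F (split 1F 3F (refute 2F 3F 1F 5F) (split 1F 5F (refute 2F 5F 1F 3F) (split 4F 5F (refute 2F
  5F 3F 4F) (cycles 1F 3F)))) (split 1F 3F (split 1F 5F (refute 3F 5F 1F 2F) (split 5F 6F (refute 3F 6F 1F 5F)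
  (cycles 1F 2F))) (cycles 0F 2F))) (cycles 0F 1F)) (cycles 0F 1F))) (split 1F 5F (split 1F 3F (split 1F 4F
  (split 1F 6F (refute 1F 3F 5F 6F) (split 1F 2F (refute 1F 3F 2F 5F) (split 5F 6F (refute 3F 5F 1F 6F)
  (cycles 1F 2F)))) (cycles 0F 1F)) (split 1F 2F (split 1F 4F (split 1F 6F (split 2F 6F (refute 2F 6F 1F 3F)
  (split 4F 5F (refute 1F 4F 2F 5F) (split 4F 6F (refute 1F 4F 2F 6F) (cycles 2F 5F)))) (split 4F 6F (split 2F
  6F (refute 2F 6F 3F 4F) (cycles 0F 1F)) (cycles 1F 3F))) (cycles 0F 1F)) (cycles 0F 2F))) (cycles 0F 1F)))
  (cycles 0F 2F))) (split 2F 6F (split 1F 6F (split 1F 3F (split 3F 4F (split 1F 5F (split 1F 4F (refute 1F 3F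
  4F 5F) (split 2F 4F (split 1F 2F (refute 2F 3F 1F 4F) (split 2F 5F (refute 3F 5F 1F 2F) (split 4F 5F (refute
  3F 4F 2F 5F) (cycles 1F 2F)))) (cycles 0F 1F))) (split 2F 5F (split 2F 4F (refute 2F 3F 4F 5F) (split 1F 2F
  (refute 2F 3F 1F 5F) (split 4F 5F (refute 3F 5F 2F 4F) (cycles 1F 2F)))) (cycles 0F 1F))) (split 2F 4F
  (split 1F 4F (split 4F 6F (refute 4F 6F 1F 2F) (split 1F 2F (refute 1F 2F 3F 6F) (split 1F 5F (split 5F 6F
  (refute 1F 5F 3F 6F) (split 4F 5F (refute 1F 5F 3F 4F) (cycles 3F 4F))) (split 2F 5F (split 4F 5F (refute 2F
  5F 3F 4F) (split 5F 6F (refute 2F 5F 3F 6F) (cycles 3F 4F))) (cycles 0F 1F))))) (cycles 0F 1F)) (cycles 0F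
  2F))) (split 1F 2F (split 1F 5F (split 2F 5F (refute 2F 5F 1F 3F) (split 1F 4F (split 4F 6F (refute 1F 6F 2F
  4F) (split 2F 4F (refute 1F 2F 4F 6F) (split 5F 6F (refute 1F 6F 2F 5F) (cycles 2F 4F)))) (split 4F 6F
  (split 2F 4F (refute 2F 6F 1F 4F) (cycles 0F 1F)) (cycles 1F 3F)))) (split 5F 6F (split 2F 5F (refute 2F 6F
  1F 5F) (cycles 0F 1F)) (cycles 1F 3F))) (cycles 0F 2F))) (cycles 0F 1F)) (cycles 0F 2F))) (split 2F 5F
  (split 1F 5F (split 1F 2F (split 1F 3F (refute 1F 2F 3F 5F) (split 1F 4F (split 2F 4F (refute 1F 2F 4F 5F)
  (split 1F 6F (split 5F 6F (refute 1F 5F 2F 6F) (split 2F 6F (refute 1F 2F 5F 6F) (split 4F 5F (refute 1F 5F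
  2F 4F) (cycles 2F 4F)))) (split 5F 6F (split 2F 6F (refute 2F 5F 1F 6F) (cycles 0F 1F)) (cycles 1F 3F))))
  (split 4F 5F (split 2F 4F (refute 2F 5F 1F 4F) (cycles 0F 1F)) (cycles 1F 3F)))) (split 2F 6F (split 5F 6F
  (split 1F 6F (refute 5F 6F 1F 2F) (split 3F 6F (refute 2F 6F 3F 5F) (cycles 0F 1F))) (split 2F 4F (split 3F
  4F (split 1F 3F (split 3F 6F (refute 2F 3F 4F 6F) (split 4F 5F (refute 2F 4F 3F 5F) (split 4F 6F (refute 2F
  4F 3F 6F) (cycles 3F 5F)))) (cycles 0F 2F)) (split 4F 6F (split 4F 5F (refute 2F 4F 5F 6F) (split 3F 6F
  (refute 2F 6F 3F 4F) (cycles 3F 4F))) (cycles 3F 4F))) (split 3F 4F (split 1F 3F (split 1F 4F (split 1F 6F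
  (split 3F 6F (refute 3F 6F 1F 2F) (split 4F 5F (refute 1F 4F 3F 5F) (split 4F 6F (refute 1F 4F 3F 6F)
  (cycles 3F 5F)))) (split 4F 5F (refute 1F 4F 3F 5F) (split 4F 6F (split 3F 6F (refute 3F 6F 2F 4F) (cycles
  0F 1F)) (cycles 1F 2F)))) (cycles 0F 1F)) (cycles 0F 2F)) (cycles 0F 2F)))) (split 1F 6F (split 1F 4F (split
  1F 3F (split 3F 6F (split 4F 6F (refute 1F 6F 3F 4F) (split 3F 4F (refute 1F 3F 4F 6F) (split 5F 6F (refute
  1F 6F 3F 5F) (cycles 3F 4F)))) (cycles 0F 2F)) (cycles 0F 2F)) (split 4F 6F (split 4F 5F (split 2F 4F (split
  3F 4F (refute 2F 4F 3F 5F) (cycles 0F 1F)) (cycles 0F 1F)) (split 1F 3F (split 3F 6F (split 3F 4F (refute 3F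
  6F 1F 4F) (cycles 0F 1F)) (cycles 0F 2F)) (cycles 0F 2F))) (cycles 1F 2F))) (cycles 0F 1F)))) (cycles 0F
  1F)) (cycles 0F 2F))) (split 1F 2F (split 1F 3F (split 2F 5F (split 2F 6F (split 2F 4F (split 1F 5F (split
  1F 6F (refute 1F 2F 5F 6F) (split 1F 4F (refute 1F 2F 4F 5F) (split 5F 6F (refute 2F 5F 1F 6F) (split 4F 5F
  (refute 2F 5F 1F 4F) (cycles 1F 4F))))) (split 4F 6F (split 1F 6F (refute 2F 6F 1F 4F) (split 4F 5F (refute
  2F 4F 5F 6F) (split 1F 4F (refute 2F 4F 1F 6F) (split 5F 6F (refute 2F 6F 4F 5F) (cycles 1F 4F))))) (split
  1F 6F (split 1F 4F (refute 1F 2F 4F 6F) (split 5F 6F (refute 2F 6F 1F 5F) (cycles 1F 4F))) (split 4F 5F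
  (split 1F 4F (refute 2F 4F 1F 5F) (split 5F 6F (refute 2F 5F 4F 6F) (cycles 1F 4F))) (cycles 1F 5F)))))
  (split 1F 5F (split 1F 6F (refute 1F 2F 5F 6F) (split 1F 4F (split 3F 4F (split 4F 5F (refute 1F 5F 2F 4F)
  (split 3F 5F (refute 1F 5F 2F 3F) (cycles 2F 3F))) (cycles 0F 2F)) (cycles 0F 1F))) (split 1F 6F (split 1F
  4F (split 3F 4F (split 4F 6F (refute 1F 6F 2F 4F) (split 3F 6F (refute 1F 3F 4F 6F) (cycles 2F 3F))) (cycles
  0F 2F)) (cycles 0F 1F)) (split 3F 5F (split 3F 6F (split 5F 6F (refute 5F 6F 2F 3F) (split 3F 4F (split 1F
  4F (split 4F 5F (refute 3F 4F 1F 5F) (split 4F 6F (refute 3F 4F 1F 6F) (cycles 1F 5F))) (cycles 0F 1F))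
  (cycles 0F 2F))) (cycles 0F 1F)) (cycles 0F 1F))))) (split 3F 6F (split 1F 6F (split 3F 5F (split 1F 5F
  (refute 1F 3F 5F 6F) (split 3F 4F (split 4F 6F (refute 3F 6F 1F 4F) (split 1F 4F (refute 1F 3F 4F 6F) (split
  5F 6F (refute 3F 6F 1F 5F) (cycles 1F 4F)))) (split 4F 6F (split 1F 4F (refute 1F 6F 3F 4F) (cycles 0F 1F))
  (cycles 2F 3F)))) (split 5F 6F (split 1F 5F (refute 1F 5F 2F 6F) (cycles 0F 1F)) (cycles 2F 3F))) (cycles 0F
  1F)) (cycles 0F 2F))) (split 3F 5F (split 1F 5F (split 3F 6F (split 1F 6F (refute 1F 3F 5F 6F) (split 3F 4F
  (split 4F 5F (refute 3F 5F 1F 4F) (split 1F 4F (refute 1F 3F 4F 5F) (split 5F 6F (refute 3F 5F 1F 6F)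
  (cycles 1F 4F)))) (split 4F 5F (split 1F 4F (refute 1F 5F 3F 4F) (cycles 0F 1F)) (cycles 2F 3F)))) (split 5F
  6F (split 1F 6F (refute 1F 5F 3F 6F) (cycles 0F 1F)) (cycles 2F 3F))) (cycles 0F 1F)) (cycles 0F 2F)))
  (cycles 0F 1F)) (cycles 0F 1F))

abstract
  starValid : Valid [] (3 ∷ []) ((0F , 1F) ∷ (0F , 2F) ∷ (0F , 3F) ∷ []) [] starCert
  starValid = toWitness {a? = valid? [] (3 ∷ []) ((0F , 1F) ∷ (0F , 2F) ∷ (0F , 3F) ∷ []) [] starCert} _

-- Any three non-neighbours of vertex 0 span at most one non-edge. Four of them are therefore
-- complete up to a matching and contain a 4-cycle.
fourCert : Cert {5}
fourCert =
  split 2F 3F (split 2F 4F (refute 0F 2F 3F 4F) (split 1F 3F (refute 0F 3F 1F 2F) (split 3F 4F (refute 0F 3F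
  2F 4F) (split 1F 2F (refute 0F 2F 1F 3F) (cycles 1F 2F))))) (split 1F 4F (split 2F 4F (refute 0F 4F 1F 2F)
  (split 1F 3F (refute 0F 1F 3F 4F) (split 3F 4F (refute 0F 4F 1F 3F) (split 1F 2F (refute 0F 1F 2F 4F)
  (cycles 1F 2F))))) (split 2F 4F (split 3F 4F (refute 0F 4F 2F 3F) (split 1F 2F (refute 0F 2F 1F 4F) (cycles
  1F 2F))) (split 1F 3F (split 3F 4F (refute 0F 3F 1F 4F) (split 1F 2F (refute 0F 1F 2F 3F) (cycles 1F 2F)))
  (cycles 1F 3F))))

abstract
  fourValid : Valid [] (3 ∷ []) [] ((0F , 1F) ∷ (0F , 2F) ∷ (0F , 3F) ∷ (0F , 4F) ∷ []) fourCert
  fourValid = toWitness {a? = valid? [] (3 ∷ []) [] ((0F , 1F) ∷ (0F , 2F) ∷ (0F , 3F) ∷ (0F , 4F) ∷ []) fourCert} _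

-- Growing cycles

module Assembly {n : ℕ} (G : Graph n) (five : Paths.FiveFree G) where

  open Paths G
  open Growing five
  open DecMembership (_≟_ {n}) using (_∈?_)

  covers⇒≤ : ∀ {M : List V} → (∀ x → x ∈ M) → n ≤ length M
  covers⇒≤ {M} all∈ = injective⇒≤ {f = Any.index ∘ all∈} λ {x} {y} eq →
    trans (Any.lookup-index (all∈ x)) (trans (cong (lookup M) eq) (sym (Any.lookup-index (all∈ y))))

  outside : ∀ M → (∃ λ x → x ∉ M) ⊎ (∀ x → x ∈ M)
  outside M with any? (λ x → ¬? (x ∈? M))
  ... | yes x∉ = inj₁ x∉
  ... | no ¬∉  = inj₂ λ x → case x ∈? M of λ { (yes x∈) → x∈ ; (no x∉) → contradiction (x , x∉) ¬∉ }

  fresh : ∀ M → length M < n → ∃ λ x → x ∉ M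
  fresh M len with outside M
  ... | inj₁ x∉  = x∉
  ... | inj₂ all∈ = contradiction (covers⇒≤ all∈) (ℕ.<⇒≱ len)

  insertUnique : ∀ {x : V} {M} → x ∉ M → Unique M → Unique (x ∷ M)
  insertUnique x∉ U = All.¬Any⇒All¬ _ x∉ ∷ U

  -- Vertex sets carrying a pancyclic edge

  Cycle : List V → Set
  Cycle M = ∃ λ u → ∃ λ v → u ~ v × Span u M v

  TwoNeighbours ThreeNeighbours : V → List V → Set
  TwoNeighbours d M   = ∃ λ x → ∃ λ y → (x ∈ M × y ∈ M) × x ≢ y × d ~ x × d ~ y
  ThreeNeighbours d M = ∃ λ x → ∃ λ y → ∃ λ z → (x ∈ M × y ∈ M × z ∈ M) × (x ≢ y × x ≢ z × y ≢ z) × d ~ x × d ~ y × d ~ z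

  -- The cycles given by `path` may use any vertices, and `k` counts vertices. Only `spanning` is
  -- tied to `M`: it is the path into which the next vertex is inserted.
  record Pancyclic (M : List V) : Set where
    field
      {u v}  : V
      edge   : u ~ v
      path   : ∀ k → 3 ≤ k → k ≤ length M → ∃ λ xs → Path u xs v × Unique xs × length xs ≡ k
      spanning : Span u M v

  open Pancyclic

  rearrangePancyclic : ∀ {M N} → M ↭ N → Pancyclic M → Pancyclic N
  rearrangePancyclic σ P = record
    { edge = edge P
    ; path = λ k 3≤k k≤ → path P k 3≤k (subst (k ≤_) (sym (↭-length σ)) k≤)
    ; spanning = rearrange σ (spanning P)
    }

  heptagon : ∀ {M} → Cycle M → Unique M → length M ≡ 7 → Pancyclic M
  heptagon (_ , _ , uv , xs , p , σ) U len =
    rearrangePancyclic σ (fromPath p (~-sym uv) (Unique-resp-↭ (↭-sym σ) U) (trans (↭-length σ) len))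
    where
    fromPath : ∀ {u xs v} → Path u xs v → v ~ u → Unique xs → length xs ≡ 7 → Pancyclic xs
    fromPath {xs = xs} (e₀ ∷ e₁ ∷ e₂ ∷ e₃ ∷ e₄ ∷ e₅ ∷ [ _ ]) e₆ U refl
      with Soundness.sound G five (lookup xs) (lookup-injective U) heptagonCert heptagonValid []
             (e₀ ∷ e₁ ∷ e₂ ∷ e₃ ∷ e₄ ∷ e₅ ∷ e₆ ∷ []) []
    ... | i , j , ij , j₂ ∷ j₃ ∷ j₄ ∷ j₅ ∷ j₆@(is , p₆ , U₆ , len₆) ∷ [] = record
      { edge = ij
      ; path = lengths
      ; spanning = _ , p₆ , map-lookup-↭ xs U₆ len₆
      }
      where
      Joined : ℕ → Set
      Joined k = ∃ λ ys → Path (lookup xs i) ys (lookup xs j) × Unique ys × length ys ≡ k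
      -- Certificates count edges, `Pancyclic` counts vertices; hence the shift by one.
      image : ∀ {k} → Soundness.Joined G five (lookup xs) (lookup-injective U) i j k → Joined (suc k)
      image (ys , q , u , eq) = _ , q , Unique.map⁺ (lookup-injective U) u , trans (List.length-map _ ys) eq
      lengths : ∀ k → 3 ≤ k → k ≤ 7 → Joined k
      lengths 3 _ _ = image j₂
      lengths 4 _ _ = image j₃
      lengths 5 _ _ = image j₄
      lengths 6 _ _ = image j₅
      lengths 7 _ _ = image j₆
      lengths (suc (suc (suc (suc (suc (suc (suc (suc _)))))))) _ (s≤s (s≤s (s≤s (s≤s (s≤s (s≤s (s≤s ())))))))
      lengths 1 (s≤s ()) _
      lengths 2 (s≤s (s≤s ())) _
    fromPath (_ ∷ _ ∷ _ ∷ _ ∷ _ ∷ _ ∷ _ ∷ [ _ ]) _ _ ()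
    fromPath (_ ∷ _ ∷ _ ∷ _ ∷ _ ∷ _ ∷ _ ∷ _ ∷ _) _ _ ()

  extend : ∀ {d M} (P : Pancyclic M) → Span (u P) (d ∷ M) (v P) → Unique (d ∷ M) → Pancyclic (d ∷ M)
  extend {d} {M} P s@(ys , q , σ) U = record { edge = edge P ; path = lengths ; spanning = s }
    where
    lengths : ∀ k → 3 ≤ k → k ≤ suc (length M) → ∃ λ xs → Path (u P) xs (v P) × Unique xs × length xs ≡ k
    lengths k 3≤k k≤ with ℕ.m≤n⇒m<n∨m≡n k≤
    ... | inj₁ (s≤s k≤′) = path P k 3≤k k≤′
    ... | inj₂ refl      = ys , q , Unique-resp-↭ (↭-sym σ) U , ↭-length σ

  three⇒two : ∀ {d M} → ThreeNeighbours d M → TwoNeighbours d M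
  three⇒two (x , y , _ , (x∈ , y∈ , _) , (x≢y , _) , dx , dy , _) = x , y , (x∈ , y∈) , x≢y , dx , dy

  TwoNeighbours-resp-↭ : ∀ {d M N} → M ↭ N → TwoNeighbours d M → TwoNeighbours d N
  TwoNeighbours-resp-↭ σ (x , y , (x∈ , y∈) , r) = x , y , (∈-resp-↭ σ x∈ , ∈-resp-↭ σ y∈) , r

  TwoNeighbours⇒¬single : ∀ {d M x} → TwoNeighbours d M → ¬ (∀ {y} → y ∈ M → d ~ y → y ≡ x)
  TwoNeighbours⇒¬single (a , b , (a∈ , b∈) , a≢b , da , db) only = a≢b (trans (only a∈ da) (sym (only b∈ db)))

  ThreeNeighbours⇒¬ends : ∀ {d M u A v} → ThreeNeighbours d M → M ↭ u ∷ A ++ v ∷ [] → ¬ Free d A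
  ThreeNeighbours⇒¬ends {d} {M} {u} {A} {v} (x , y , z , (x∈ , y∈ , z∈) , (x≢y , x≢z , y≢z) , dx , dy , dz) σ ¬dA
    with side x∈ dx | side y∈ dy | side z∈ dz
    where
    side : ∀ {w} → w ∈ M → d ~ w → w ≡ u ⊎ w ≡ v
    side w∈ dw with ∈-resp-↭ σ w∈
    ... | here w≡u = inj₁ w≡u
    ... | there w∈′ = inj₂ (onlyAt A ¬dA [] w∈′ dw)
  ... | inj₁ refl | inj₁ refl | _         = x≢y refl
  ... | inj₁ refl | inj₂ refl | inj₁ refl = x≢z refl
  ... | inj₁ refl | inj₂ refl | inj₂ refl = y≢z refl
  ... | inj₂ refl | inj₂ refl | _         = x≢y refl
  ... | inj₂ refl | inj₁ refl | inj₂ refl = x≢z refl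
  ... | inj₂ refl | inj₁ refl | inj₁ refl = y≢z refl

  -- A third neighbour excludes both obstructions of `grow`. This case comes before `addVertex`
  -- because `restart`, on which `addVertex` relies, refills its heptagon by it.
  addVertex₃ : ∀ {d M} → Pancyclic M → 7 ≤ length M → Unique (d ∷ M) → ThreeNeighbours d M → Pancyclic (d ∷ M)
  addVertex₃ {d} P len U t with spanning P
  ... | xs , p , σ with grow p (Unique-resp-↭ (prep d (↭-sym σ)) U) (subst (7 ≤_) (sym (↭-length σ)) len)
  ...   | grown s            = extend P (rearrange (prep d σ) s) U
  ...   | few x only         = ⊥-elim (TwoNeighbours⇒¬single (TwoNeighbours-resp-↭ (↭-sym σ) (three⇒two t)) only)
  ...   | ends _ _ _ ¬dA _ _ = ⊥-elim (ThreeNeighbours⇒¬ends t (↭-sym σ) ¬dA)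

  -- Neighbours are counted in the fixed set `S`, so they persist as vertices of `I` are added one
  -- after another.
  fill₃ : ∀ I {S} → Pancyclic S → 7 ≤ length S → Unique (I ++ S) → All (λ w → ThreeNeighbours w S) I → Pancyclic (I ++ S)
  fill₃ []      P _ _ _ = P
  fill₃ (w ∷ I) {S} P len U@(_ ∷ U′) ((x , y , z , (x∈ , y∈ , z∈) , r) ∷ ts) =
    addVertex₃ (fill₃ I P len U′ ts)
      (ℕ.≤-trans len (subst (length S ≤_) (sym (List.length-++ I)) (ℕ.m≤n+m (length S) (length I)))) U
      (x , y , z , (∈-++⁺ʳ I x∈ , ∈-++⁺ʳ I y∈ , ∈-++⁺ʳ I z∈) , r)

  unsnoc : ∀ {w xs z} → Path w xs z → ∃ λ I → xs ≡ I ++ z ∷ []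
  unsnoc [ _ ] = [] , refl
  unsnoc (_∷_ {w} _ p) with unsnoc p
  ... | I , refl = w ∷ I , refl

  -- The edge uv is useless when u and v are the only neighbours of d; but then the vertices of A are
  -- pairwise adjacent up to a matching, and a new heptagon through d can be refilled from A.
  restart : ∀ {d u a a′ v A} → d ~ u → u ~ a → Path a A a′ → Free d A → a′ ~ v → d ~ v →
            Unique (d ∷ u ∷ A ++ v ∷ []) → 7 ≤ length (u ∷ A ++ v ∷ []) → Pancyclic (d ∷ u ∷ A ++ v ∷ [])
  restart _ _ [ _ ] _ _ _ _ (s≤s (s≤s (s≤s ())))
  restart _ _ (_ ∷ [ _ ]) _ _ _ _ (s≤s (s≤s (s≤s (s≤s ()))))
  restart _ _ (_ ∷ _ ∷ [ _ ]) _ _ _ _ (s≤s (s≤s (s≤s (s≤s (s≤s ())))))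
  restart {d} {u} {a} {a′} {v} du ua (e₁ ∷ _∷_ {a₂} {a₃} e₂ (e₃ ∷ p)) ¬dA a′v dv U@(d∉ ∷ _ ∷ UAv) len with unsnoc p
  ... | I , refl = rearrangePancyclic σ (fill₃ I (heptagon cycle US refl) ℕ.≤-refl (Unique-resp-↭ (↭-sym σ) U) (All.tabulate threes))
    where
    open Reorder using (solve; _⊜_; _⊕_)
    A S : List V
    A = a ∷ a₂ ∷ a₃ ∷ I ++ a′ ∷ []
    S = d ∷ u ∷ a ∷ a₂ ∷ a₃ ∷ a′ ∷ v ∷ []
    σ : I ++ S ↭ d ∷ u ∷ A ++ v ∷ []
    σ = solve 4 (λ i x y v → i ⊕ x ⊕ y ⊕ v ⊜ x ⊕ (i ⊕ y) ⊕ v) ↭-refl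
          I (d ∷ u ∷ a ∷ a₂ ∷ a₃ ∷ []) (a′ ∷ []) (v ∷ [])
    US : Unique S
    US = Unique-++⁻ʳ I (Unique-resp-↭ (↭-sym σ) U)
    UA : Unique A
    UA = Unique-++⁻ˡ A UAv
    -- Since `d` misses all of `A`, two non-edges at `w` inside `A` would be the fourth and fifth
    -- among `d`, `w`, `x`, `y`. So the non-edges within `A` form a matching.
    near : ∀ {w x y} → w ∈ A → x ∈ A → y ∈ A → w ≢ x → w ≢ y → x ≢ y → w ≁ x → w ~ y
    near w∈ x∈ y∈ wx wy xy ¬wx = stable λ ¬wy →
      five (d≢ w∈) (d≢ x∈) (d≢ y∈) wx wy xy (All.lookup ¬dA w∈) (All.lookup ¬dA x∈) (All.lookup ¬dA y∈) ¬wx ¬wy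
      where
      d≢ : ∀ {z} → z ∈ A → d ≢ z
      d≢ z∈ = All.lookup d∉ (there (∈-++⁺ˡ z∈))
    at₁ : a ∈ A
    at₁ = here refl
    at₂ : a₂ ∈ A
    at₂ = there (here refl)
    at₃ : a₃ ∈ A
    at₃ = there (there (here refl))
    at′ : a′ ∈ A
    at′ = there (there (there (∈-++⁺ʳ I (here refl))))
    within : ∀ {w} → w ∈ I → w ∈ A
    within w∈ = there (there (there (∈-++⁺ˡ w∈)))
    cycle : Cycle S
    cycle with US | a₃ ~? a′
    ... | _ | yes a₃a′ = d , v , dv , span (du ∷ ua ∷ e₁ ∷ e₂ ∷ a₃a′ ∷ a′v ∷ [ v ])
    -- If `a₃` and `a′` are not adjacent, each is joined to all other vertices of `A`, so `a₂` and
    -- `a₃` can be interchanged on the cycle.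
    ... | _ ∷ _ ∷ (a≢a₂ ∷ a≢a₃ ∷ a≢a′ ∷ _) ∷ (a₂≢a₃ ∷ a₂≢a′ ∷ _) ∷ (a₃≢a′ ∷ _) ∷ _ | no ¬a₃a′ =
      d , v , dv , _ ,
      du ∷ ua ∷ ~-sym (near at₃ at′ at₁ a₃≢a′ (a≢a₃ ∘ sym) (a≢a′ ∘ sym) ¬a₃a′) ∷ ~-sym e₂
         ∷ ~-sym (near at′ at₃ at₂ (a₃≢a′ ∘ sym) (a₂≢a′ ∘ sym) (a₂≢a₃ ∘ sym) (¬a₃a′ ∘ ~-sym)) ∷ a′v ∷ [ v ] ,
      prep d (prep u (prep a (swap a₃ a₂ ↭-refl)))
    -- By `near`, `w` misses at most one of `a`, `a₂`, `a₃`, `a′`.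
    threes : ∀ {w} → w ∈ I → ThreeNeighbours w S
    threes {w} w∈ with US | w ~? a | w ~? a₂ | w ~? a₃
    ... | _ ∷ _ ∷ (a≢a₂ ∷ a≢a₃ ∷ a≢a′ ∷ _) ∷ (a₂≢a₃ ∷ a₂≢a′ ∷ _) ∷ (a₃≢a′ ∷ _) ∷ _ | wa? | wa₂? | wa₃? = pick wa? wa₂? wa₃?
      where
      w≢ : w ≢ a × w ≢ a₂ × w ≢ a₃ × w ≢ a′
      w≢ with UA
      ... | a∉ ∷ a₂∉ ∷ a₃∉ ∷ UI =
        All.lookup a∉ (there (there (∈-++⁺ˡ w∈))) ∘ sym , All.lookup a₂∉ (there (∈-++⁺ˡ w∈)) ∘ sym ,
        All.lookup a₃∉ (∈-++⁺ˡ w∈) ∘ sym , Unique-++⁻-apart UI w∈ (here refl)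
      w≢a = proj₁ w≢
      w≢a₂ = proj₁ (proj₂ w≢)
      w≢a₃ = proj₁ (proj₂ (proj₂ w≢))
      w≢a′ = proj₂ (proj₂ (proj₂ w≢))
      in₁ : a ∈ S
      in₁ = there (there (here refl))
      in₂ : a₂ ∈ S
      in₂ = there (there (there (here refl)))
      in₃ : a₃ ∈ S
      in₃ = there (there (there (there (here refl))))
      in′ : a′ ∈ S
      in′ = there (there (there (there (there (here refl)))))
      pick : Dec (w ~ a) → Dec (w ~ a₂) → Dec (w ~ a₃) → ThreeNeighbours w S
      pick (yes wa) (yes wa₂) (yes wa₃) = a , a₂ , a₃ , (in₁ , in₂ , in₃) , (a≢a₂ , a≢a₃ , a₂≢a₃) , wa , wa₂ , wa₃
      pick (yes wa) (yes wa₂) (no ¬wa₃) =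
        a , a₂ , a′ , (in₁ , in₂ , in′) , (a≢a₂ , a≢a′ , a₂≢a′) , wa , wa₂ ,
        near (within w∈) at₃ at′ w≢a₃ w≢a′ a₃≢a′ ¬wa₃
      pick (yes wa) (no ¬wa₂) _ =
        a , a₃ , a′ , (in₁ , in₃ , in′) , (a≢a₃ , a≢a′ , a₃≢a′) , wa ,
        near (within w∈) at₂ at₃ w≢a₂ w≢a₃ a₂≢a₃ ¬wa₂ , near (within w∈) at₂ at′ w≢a₂ w≢a′ a₂≢a′ ¬wa₂
      pick (no ¬wa) _ _ =
        a₂ , a₃ , a′ , (in₂ , in₃ , in′) , (a₂≢a₃ , a₂≢a′ , a₃≢a′) ,
        near (within w∈) at₁ at₂ w≢a w≢a₂ a≢a₂ ¬wa , near (within w∈) at₁ at₃ w≢a w≢a₃ a≢a₃ ¬wa ,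
        near (within w∈) at₁ at′ w≢a w≢a′ a≢a′ ¬wa

  addVertex : ∀ {d M} → Pancyclic M → 7 ≤ length M → Unique (d ∷ M) → TwoNeighbours d M → Pancyclic (d ∷ M)
  addVertex {d} P len U t with spanning P
  ... | xs , p , σ with Unique-resp-↭ (prep d (↭-sym σ)) U | subst (7 ≤_) (sym (↭-length σ)) len
  ...   | U′ | len′ with grow p U′ len′
  ...     | grown s                   = extend P (rearrange (prep d σ) s) U
  ...     | few x only                = ⊥-elim (TwoNeighbours⇒¬single (TwoNeighbours-resp-↭ (↭-sym σ) t) only)
  ...     | ends du ua q ¬dA a′v dv = rearrangePancyclic (prep d σ) (restart du ua q ¬dA a′v dv U′ len′)

  -- Adding a vertex to a cycle of length five or six

  closed : ∀ {L : List V} {k} (U : Unique L) → length L ≡ suc k →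
           Soundness.Found G five (lookup L) (lookup-injective U) (k ∷ []) → Cycle L
  closed {L} U len (i , j , ij , (is , p , Uis , lenᵢ) ∷ []) =
    _ , _ , ij , _ , p , map-lookup-↭ L Uis (trans lenᵢ (sym len))

  addBusy : ∀ {d xs} → TwoNeighbours d xs → let L = xs ++ d ∷ [] in
            ∃ λ i → ∃ λ j → i ≢ j × d ~ lookup L i × d ~ lookup L j
  addBusy {d} {xs} (x , y , (x∈ , y∈) , x≢y , dx , dy) =
    _ , _ , (λ eq → x≢y (trans x≡ (trans (cong (lookup (xs ++ d ∷ [])) eq) (sym y≡)))) ,
    subst (d ~_) x≡ dx , subst (d ~_) y≡ dy
    where
    x≡ = Any.lookup-index (∈-++⁺ˡ {ys = d ∷ []} x∈)
    y≡ = Any.lookup-index (∈-++⁺ˡ {ys = d ∷ []} y∈)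

  addToPentagon : ∀ {d M} → Cycle M → Unique (d ∷ M) → length M ≡ 5 → TwoNeighbours d M → Cycle (d ∷ M)
  addToPentagon {d} (_ , _ , uv , xs , p , σ) U len t =
    fromPath p (~-sym uv) (↭-trans (shift d xs []) (prep d (↭-trans (↭-reflexive (List.++-identityʳ xs)) σ)))
      (trans (↭-length σ) len) (TwoNeighbours-resp-↭ (↭-sym σ) t)
    where
    fromPath : ∀ {u xs v} → Path u xs v → v ~ u → xs ++ d ∷ [] ↭ d ∷ _ → length xs ≡ 5 → TwoNeighbours d xs → Cycle (d ∷ _)
    fromPath (e₀ ∷ e₁ ∷ e₂ ∷ e₃ ∷ [ _ ]) e₄ τ refl t with Unique-resp-↭ (↭-sym τ) U
    ... | U′ with closed U′ refl (Soundness.sound G five (lookup _) (lookup-injective U′) pentagonCert pentagonValid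
                    (addBusy t ∷ []) (e₀ ∷ e₁ ∷ e₂ ∷ e₃ ∷ e₄ ∷ []) [])
    ...   | i , j , ij , s = i , j , ij , rearrange τ s
    fromPath (_ ∷ _ ∷ _ ∷ _ ∷ _ ∷ [ _ ]) _ _ ()
    fromPath (_ ∷ _ ∷ _ ∷ _ ∷ _ ∷ _ ∷ _) _ _ ()

  addToHexagon : ∀ {d M} → Cycle M → Unique (d ∷ M) → length M ≡ 6 → TwoNeighbours d M → Cycle (d ∷ M)
  addToHexagon {d} (_ , _ , uv , xs , p , σ) U len t =
    fromPath p (~-sym uv) (↭-trans (shift d xs []) (prep d (↭-trans (↭-reflexive (List.++-identityʳ xs)) σ)))
      (trans (↭-length σ) len) (TwoNeighbours-resp-↭ (↭-sym σ) t)
    where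
    fromPath : ∀ {u xs v} → Path u xs v → v ~ u → xs ++ d ∷ [] ↭ d ∷ _ → length xs ≡ 6 → TwoNeighbours d xs → Cycle (d ∷ _)
    fromPath (e₀ ∷ e₁ ∷ e₂ ∷ e₃ ∷ e₄ ∷ [ _ ]) e₅ τ refl t with Unique-resp-↭ (↭-sym τ) U
    ... | U′ with closed U′ refl (Soundness.sound G five (lookup _) (lookup-injective U′) hexagonCert hexagonValid
                    (addBusy t ∷ []) (e₀ ∷ e₁ ∷ e₂ ∷ e₃ ∷ e₄ ∷ e₅ ∷ []) [])
    ...   | i , j , ij , s = i , j , ij , rearrange τ s
    fromPath (_ ∷ _ ∷ _ ∷ _ ∷ _ ∷ _ ∷ [ _ ]) _ _ ()
    fromPath (_ ∷ _ ∷ _ ∷ _ ∷ _ ∷ _ ∷ _ ∷ _) _ _ ()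

  -- Cycles that cannot be grown, and two disjoint edges leaving them

  Isolating : List V → Set
  Isolating M = ∀ {d x y} → d ∉ M → x ∈ M → y ∈ M → d ~ x → d ~ y → x ≡ y

  attach : ∀ M → (∃ λ d → d ∉ M × TwoNeighbours d M) ⊎ Isolating M
  attach M with any? (λ d → ¬? (d ∈? M) ×-dec any? (λ x → any? (λ y →
                  ((x ∈? M) ×-dec (y ∈? M)) ×-dec ¬? (x ≟ y) ×-dec (d ~? x) ×-dec (d ~? y))))
  ... | yes found = inj₁ found
  ... | no none   = inj₂ λ {d} {x} {y} d∉ x∈ y∈ dx dy → case x ≟ y of λ
    { (yes eq) → eq ; (no x≢y) → contradiction (d , d∉ , x , y , (x∈ , y∈) , x≢y , dx , dy) none }

  -- The first edge of the walk that leaves `M`. For a walk avoiding a vertex, `ok p` tells that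
  -- this edge does not start there.
  crossing : ∀ {M ok x y} → Walk G ok x y → x ∈ M → y ∉ M → ∃ λ p → ∃ λ q → p ∈ M × q ∉ M × p ~ q × ok p
  crossing (Walk.here _) x∈ y∉ = contradiction x∈ y∉
  crossing {M} (Walk.step {y = y} okx xy w) x∈ y∉ with y ∈? M
  ... | yes y∈ = crossing w y∈ y∉
  ... | no y∉′ = _ , y , x∈ , y∉′ , xy , okx

  record Bridges (M : List V) : Set where
    field
      {p₁ p₂ q₁ q₂} : V
      p₁∈ : p₁ ∈ M
      p₂∈ : p₂ ∈ M
      q₁∉ : q₁ ∉ M
      q₂∉ : q₂ ∉ M
      p₁≢p₂ : p₁ ≢ p₂
      q₁≢q₂ : q₁ ≢ q₂
      p₁q₁ : p₁ ~ q₁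
      p₂q₂ : p₂ ~ q₂

  -- Connectivity gives a first edge leaving `M` at `p₁`. Another vertex of `M` still reaches `q₁`
  -- after `p₁` is deleted, and this gives the second edge; the two outer ends differ because a
  -- common one would have two neighbours in `M`.
  bridges : ∀ {x y o M} → TwoConnected G → Isolating M → x ∈ M → y ∈ M → x ≢ y → o ∉ M → Bridges M
  bridges {x} {y} {o} {M} (_ , conn , conn₁) iso x∈ y∈ x≢y o∉ with crossing (conn x o) x∈ o∉
  ... | p₁ , q₁ , p₁∈ , q₁∉ , p₁q₁ , _ = second other
    where
    other : ∃ λ z → z ∈ M × z ≢ p₁
    other with x ≟ p₁
    ... | yes refl = y , y∈ , x≢y ∘ sym
    ... | no x≢p₁  = x , x∈ , x≢p₁
    second : (∃ λ z → z ∈ M × z ≢ p₁) → Bridges M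
    second (z , z∈ , z≢p₁) with crossing (conn₁ p₁ z q₁ z≢p₁ λ { refl → q₁∉ p₁∈ }) z∈ q₁∉
    ... | p₂ , q₂ , p₂∈ , q₂∉ , p₂q₂ , p₂≢p₁ = record
      { p₁∈ = p₁∈ ; p₂∈ = p₂∈ ; q₁∉ = q₁∉ ; q₂∉ = q₂∉ ; p₁≢p₂ = p₂≢p₁ ∘ sym ; p₁q₁ = p₁q₁ ; p₂q₂ = p₂q₂
      ; q₁≢q₂ = λ { refl → p₂≢p₁ (iso q₁∉ p₂∈ p₁∈ (~-sym p₂q₂) (~-sym p₁q₁)) } }

  ∈∉⇒≢ : ∀ {x y : V} {M} → x ∈ M → y ∉ M → y ≢ x
  ∈∉⇒≢ x∈ y∉ refl = y∉ x∈

  module Bridged {M} (iso : Isolating M) (B : Bridges M) where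
    open Bridges B

    q₁≁ : ∀ {w} → w ∈ M → w ≢ p₁ → q₁ ≁ w
    q₁≁ w∈ w≢p₁ q₁w = w≢p₁ (iso q₁∉ w∈ p₁∈ q₁w (~-sym p₁q₁))

    q₂≁ : ∀ {w} → w ∈ M → w ≢ p₂ → q₂ ≁ w
    q₂≁ w∈ w≢p₂ q₂w = w≢p₂ (iso q₂∉ w∈ p₂∈ q₂w (~-sym p₂q₂))

    Inner : V → Set
    Inner w = w ∈ M × w ≢ p₁ × w ≢ p₂

    -- Neither `q₁` nor `q₂` has an inner neighbour. These are four non-edges among `q₁`, `q₂`, `w`,
    -- `w′`, so the other two pairs are edges; the second one is `inner-clique`.
    q₁q₂ : ∀ {w w′} → Inner w → Inner w′ → w ≢ w′ → q₁ ~ q₂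
    q₁q₂ (w∈ , w≢p₁ , w≢p₂) (w′∈ , w′≢p₁ , w′≢p₂) w≢w′ = stable λ ¬q₁q₂ →
      five q₁≢q₂ (∈∉⇒≢ w∈ q₁∉) (∈∉⇒≢ w′∈ q₁∉) (∈∉⇒≢ w∈ q₂∉) (∈∉⇒≢ w′∈ q₂∉) w≢w′
        ¬q₁q₂ (q₁≁ w∈ w≢p₁) (q₁≁ w′∈ w′≢p₁) (q₂≁ w∈ w≢p₂) (q₂≁ w′∈ w′≢p₂)

    inner-clique : ∀ {w w′} → Inner w → Inner w′ → w ≢ w′ → w ~ w′
    inner-clique (w∈ , w≢p₁ , w≢p₂) (w′∈ , w′≢p₁ , w′≢p₂) w≢w′ = stable λ ¬ww′ →
      five w≢w′ (∈∉⇒≢ w∈ q₁∉ ∘ sym) (∈∉⇒≢ w∈ q₂∉ ∘ sym) (∈∉⇒≢ w′∈ q₁∉ ∘ sym) (∈∉⇒≢ w′∈ q₂∉ ∘ sym) q₁≢q₂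
        ¬ww′ (q₁≁ w∈ w≢p₁ ∘ ~-sym) (q₂≁ w∈ w≢p₂ ∘ ~-sym) (q₁≁ w′∈ w′≢p₁ ∘ ~-sym) (q₂≁ w′∈ w′≢p₂ ∘ ~-sym)

    -- The vertex `q₂` misses `p₁`, `w` and `w′`, so at most one more non-edge is possible there:
    -- `p₁` misses at most one inner vertex.
    p₁-near : ∀ {w w′} → Inner w → Inner w′ → w ≢ w′ → p₁ ≁ w → p₁ ~ w′
    p₁-near (w∈ , w≢p₁ , w≢p₂) (w′∈ , w′≢p₁ , w′≢p₂) w≢w′ ¬p₁w = stable λ ¬p₁w′ →
      five (∈∉⇒≢ p₁∈ q₂∉) (∈∉⇒≢ w∈ q₂∉) (∈∉⇒≢ w′∈ q₂∉) (w≢p₁ ∘ sym) (w′≢p₁ ∘ sym) w≢w′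
        (q₂≁ p₁∈ p₁≢p₂) (q₂≁ w∈ w≢p₂) (q₂≁ w′∈ w′≢p₂) ¬p₁w ¬p₁w′

    p₂-near : ∀ {w w′} → Inner w → Inner w′ → w ≢ w′ → p₂ ≁ w → p₂ ~ w′
    p₂-near (w∈ , w≢p₁ , w≢p₂) (w′∈ , w′≢p₁ , w′≢p₂) w≢w′ ¬p₂w = stable λ ¬p₂w′ →
      five (∈∉⇒≢ p₂∈ q₁∉) (∈∉⇒≢ w∈ q₁∉) (∈∉⇒≢ w′∈ q₁∉) (w≢p₂ ∘ sym) (w′≢p₂ ∘ sym) w≢w′
        (q₁≁ p₂∈ (p₁≢p₂ ∘ sym)) (q₁≁ w∈ w≢p₁) (q₁≁ w′∈ w′≢p₁) ¬p₂w ¬p₂w′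

    -- Both `d` and `q₁` miss `w` and `w′`, which are four non-edges, so `d` and `q₁` are adjacent;
    -- likewise for `q₂`.
    outer-joined : ∀ {d w w′} → d ∉ M → Inner w → Inner w′ → w ≢ w′ → d ≁ w → d ≁ w′ →
                   d ≢ q₁ → d ≢ q₂ → d ~ q₁ × d ~ q₂
    outer-joined d∉ (w∈ , w≢p₁ , w≢p₂) (w′∈ , w′≢p₁ , w′≢p₂) w≢w′ ¬dw ¬dw′ d≢q₁ d≢q₂ =
      stable (λ ¬dq → five d≢q₁ (∈∉⇒≢ w∈ d∉) (∈∉⇒≢ w′∈ d∉) (∈∉⇒≢ w∈ q₁∉) (∈∉⇒≢ w′∈ q₁∉) w≢w′
                        ¬dq ¬dw ¬dw′ (q₁≁ w∈ w≢p₁) (q₁≁ w′∈ w′≢p₁)) ,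
      stable (λ ¬dq → five d≢q₂ (∈∉⇒≢ w∈ d∉) (∈∉⇒≢ w′∈ d∉) (∈∉⇒≢ w∈ q₂∉) (∈∉⇒≢ w′∈ q₂∉) w≢w′
                        ¬dq ¬dw ¬dw′ (q₂≁ w∈ w≢p₂) (q₂≁ w′∈ w′≢p₂))

  -- A 7-cycle through both bridges, filled up to the whole graph

  SpanningPancyclic : Set
  SpanningPancyclic = ∃ λ M → Pancyclic M × n ≤ length M

  -- `S` stays fixed while `M` grows, so two neighbours in `S` suffice whenever a vertex of `ds` has
  -- its turn; `ds` may repeat vertices already present.
  fill₂ : ∀ ds {S M} → Pancyclic M → 7 ≤ length M → Unique M → (∀ {x} → x ∈ S → x ∈ M) →
            (∀ d → d ∉ S → TwoNeighbours d S) → ∃ λ N → Pancyclic N × (∀ {x} → x ∈ M → x ∈ N) × (∀ {x} → x ∈ ds → x ∈ N)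
  fill₂ [] {M = M} P _ _ _ _ = M , P , (λ x∈ → x∈) , λ ()
  fill₂ (d ∷ ds) {M = M} P len U sub twos with d ∈? M
  ... | yes d∈ with fill₂ ds P len U sub twos
  ...   | N , Q , M⊆ , ds⊆ = N , Q , M⊆ , λ { (here refl) → M⊆ d∈ ; (there x∈) → ds⊆ x∈ }
  fill₂ (d ∷ ds) {M = M} P len U sub twos | no d∉ with insertUnique d∉ U | twos d (d∉ ∘ sub)
  ... | U′ | x , y , (x∈ , y∈) , r
    with fill₂ ds (addVertex P len U′ (x , y , (sub x∈ , sub y∈) , r)) (ℕ.m≤n⇒m≤1+n len) U′ (there ∘ sub) twos
  ...   | N , Q , M⊆ , ds⊆ = N , Q , M⊆ ∘ there , λ { (here refl) → M⊆ (here refl) ; (there x∈) → ds⊆ x∈ }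

  -- Five vertices leave three inner ones. With `z₁` adjacent to `p₁`, `z₂` adjacent to `p₂` and a
  -- third inner vertex `x`, the sequence `p₁`, `z₁`, `x`, `z₂`, `p₂`, `q₂`, `q₁` is a 7-cycle.
  fromBridges : ∀ {M} → Isolating M → (B : Bridges M) → Unique M → 5 ≤ length M → SpanningPancyclic
  fromBridges {M} iso B U len with extract p₁∈
    where open Bridges B
  ... | M₁ , σ₁ = second σ₁
    where
    open Bridges B
    open Bridged iso B

    byVertices : ∀ {z₁ x z₂} → Inner z₁ → Inner x → Inner z₂ → z₁ ≢ x → z₁ ≢ z₂ → x ≢ z₂ →
                 p₁ ~ z₁ → p₂ ~ z₂ → SpanningPancyclic
    byVertices {z₁} {x} {z₂} iz₁ ix iz₂ z₁≢x z₁≢z₂ x≢z₂ p₁z₁ p₂z₂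
      with fill₂ (allFin n) (heptagon cycle US refl) ℕ.≤-refl US (λ s → s) twos
      where
      S : List V
      S = p₁ ∷ z₁ ∷ x ∷ z₂ ∷ p₂ ∷ q₂ ∷ q₁ ∷ []
      cycle : Cycle S
      cycle = p₁ , q₁ , p₁q₁ ,
        span (p₁z₁ ∷ inner-clique iz₁ ix z₁≢x ∷ inner-clique ix iz₂ x≢z₂ ∷ ~-sym p₂z₂ ∷ p₂q₂ ∷ ~-sym (q₁q₂ iz₁ ix z₁≢x) ∷ [ q₁ ])
      q₁≢ : ∀ {w} → w ∈ M → w ≢ q₁
      q₁≢ w∈ = ∈∉⇒≢ w∈ q₁∉ ∘ sym
      q₂≢ : ∀ {w} → w ∈ M → w ≢ q₂
      q₂≢ w∈ = ∈∉⇒≢ w∈ q₂∉ ∘ sym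
      US : Unique S
      US = (proj₁ (proj₂ iz₁) ∘ sym ∷ proj₁ (proj₂ ix) ∘ sym ∷ proj₁ (proj₂ iz₂) ∘ sym ∷ p₁≢p₂ ∷ q₂≢ p₁∈ ∷ q₁≢ p₁∈ ∷ [])
         ∷ (z₁≢x ∷ z₁≢z₂ ∷ proj₂ (proj₂ iz₁) ∷ q₂≢ (proj₁ iz₁) ∷ q₁≢ (proj₁ iz₁) ∷ [])
         ∷ (x≢z₂ ∷ proj₂ (proj₂ ix) ∷ q₂≢ (proj₁ ix) ∷ q₁≢ (proj₁ ix) ∷ [])
         ∷ (proj₂ (proj₂ iz₂) ∷ q₂≢ (proj₁ iz₂) ∷ q₁≢ (proj₁ iz₂) ∷ [])
         ∷ (q₂≢ p₂∈ ∷ q₁≢ p₂∈ ∷ []) ∷ (q₁≢q₂ ∘ sym ∷ []) ∷ [] ∷ []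
      ≢q₁ : ∀ {d} → d ∉ S → d ≢ q₁
      ≢q₁ d∉S refl = d∉S (there (there (there (there (there (there (here refl)))))))
      ≢q₂ : ∀ {d} → d ∉ S → d ≢ q₂
      ≢q₂ d∉S refl = d∉S (there (there (there (there (there (here refl))))))
      qs : ∀ {d} → d ~ q₁ × d ~ q₂ → TwoNeighbours d S
      qs (dq₁ , dq₂) = q₁ , q₂ ,
        (there (there (there (there (there (there (here refl)))))) , there (there (there (there (there (here refl)))))) ,
        q₁≢q₂ , dq₁ , dq₂
      -- In `M`, a vertex off the 7-cycle is inner and so joined to `z₁` and `x`. Outside `M`, it
      -- has at most one neighbour among `z₁`, `x`, `z₂`; the two it misses make it adjacent to `q₁`
      -- and `q₂`.
      twos : ∀ d → d ∉ S → TwoNeighbours d S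
      twos d d∉S with d ∈? M | d ~? z₁ | d ~? x
      ... | yes d∈ | _ | _ = z₁ , x , (there (here refl) , there (there (here refl))) , z₁≢x ,
        inner-clique id iz₁ (λ { refl → d∉S (there (here refl)) }) , inner-clique id ix (λ { refl → d∉S (there (there (here refl))) })
        where
        id : Inner d
        id = d∈ , (λ { refl → d∉S (here refl) }) , λ { refl → d∉S (there (there (there (there (here refl))))) }
      ... | no d∉ | yes dz₁ | _ =
        qs (outer-joined d∉ ix iz₂ x≢z₂ (λ dx → z₁≢x (iso d∉ (proj₁ iz₁) (proj₁ ix) dz₁ dx))
             (λ dz₂ → z₁≢z₂ (iso d∉ (proj₁ iz₁) (proj₁ iz₂) dz₁ dz₂)) (≢q₁ d∉S) (≢q₂ d∉S))
      ... | no d∉ | no ¬dz₁ | yes dx =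
        qs (outer-joined d∉ iz₁ iz₂ z₁≢z₂ ¬dz₁ (λ dz₂ → x≢z₂ (iso d∉ (proj₁ ix) (proj₁ iz₂) dx dz₂)) (≢q₁ d∉S) (≢q₂ d∉S))
      ... | no d∉ | no ¬dz₁ | no ¬dx = qs (outer-joined d∉ iz₁ ix z₁≢x ¬dz₁ ¬dx (≢q₁ d∉S) (≢q₂ d∉S))
    ... | N , Q , _ , all∈ = N , Q , covers⇒≤ (λ x → all∈ (∈-allFin x))

    -- Each of `p₁` and `p₂` misses at most one of the three inner vertices, so distinct neighbours
    -- can be chosen for them.
    choose : ∀ {w₁ w₂ w₃} → Inner w₁ → Inner w₂ → Inner w₃ → w₁ ≢ w₂ → w₁ ≢ w₃ → w₂ ≢ w₃ → SpanningPancyclic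
    choose {w₁} {w₂} {w₃} i₁ i₂ i₃ n₁₂ n₁₃ n₂₃ with p₁ ~? w₁ | p₂ ~? w₂ | p₂ ~? w₁
    ... | yes e₁ | yes e₂ | _      = byVertices i₁ i₃ i₂ n₁₃ n₁₂ (n₂₃ ∘ sym) e₁ e₂
    ... | yes e₁ | no ¬e₂ | _      = byVertices i₁ i₂ i₃ n₁₂ n₁₃ n₂₃ e₁ (p₂-near i₂ i₃ n₂₃ ¬e₂)
    ... | no ¬e₁ | _      | yes e₂ = byVertices i₂ i₃ i₁ n₂₃ (n₁₂ ∘ sym) (n₁₃ ∘ sym) (p₁-near i₁ i₂ n₁₂ ¬e₁) e₂
    ... | no ¬e₁ | _      | no ¬e₂ = byVertices i₂ i₁ i₃ (n₁₂ ∘ sym) n₂₃ n₁₃ (p₁-near i₁ i₂ n₁₂ ¬e₁) (p₂-near i₁ i₃ n₁₃ ¬e₂)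

    third : ∀ {M₂} → M ↭ p₁ ∷ p₂ ∷ M₂ → SpanningPancyclic
    third {M₂} σ with Unique-resp-↭ σ U | subst (5 ≤_) (↭-length σ) len
    third {w₁ ∷ w₂ ∷ w₃ ∷ _} σ | (_ ∷ p₁w₁ ∷ p₁w₂ ∷ p₁w₃ ∷ _) ∷ (p₂w₁ ∷ p₂w₂ ∷ p₂w₃ ∷ _) ∷ (n₁₂ ∷ n₁₃ ∷ _) ∷ (n₂₃ ∷ _) ∷ _ | _ =
      choose (back (here refl) , p₁w₁ ∘ sym , p₂w₁ ∘ sym) (back (there (here refl)) , p₁w₂ ∘ sym , p₂w₂ ∘ sym)
             (back (there (there (here refl))) , p₁w₃ ∘ sym , p₂w₃ ∘ sym) n₁₂ n₁₃ n₂₃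
      where
      back : ∀ {w} → w ∈ w₁ ∷ w₂ ∷ w₃ ∷ _ → w ∈ M
      back w∈ = ∈-resp-↭ (↭-sym σ) (there (there w∈))
    third {[]} σ | _ | s≤s (s≤s ())
    third {_ ∷ []} σ | _ | s≤s (s≤s (s≤s ()))
    third {_ ∷ _ ∷ []} σ | _ | s≤s (s≤s (s≤s (s≤s ())))

    second : ∀ {M₁} → M ↭ p₁ ∷ M₁ → SpanningPancyclic
    second σ with ∈-resp-↭ σ p₂∈
    ... | here p₂≡p₁ = contradiction (sym p₂≡p₁) p₁≢p₂
    ... | there p₂∈′ = third (↭-trans σ (prep p₁ (proj₂ (extract p₂∈′))))

  -- From a cycle of length five to all vertices

  module _ (conn : TwoConnected G) where

    stuck : ∀ {M} → Isolating M → Unique M → 5 ≤ length M → (∃ λ o → o ∉ M) → SpanningPancyclic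
    stuck {x ∷ y ∷ M} iso U@((x≢y ∷ _) ∷ _) len (o , o∉) =
      fromBridges iso (bridges conn iso (here refl) (there (here refl)) x≢y o∉) U len
    stuck {_ ∷ []} _ _ (s≤s ()) _

    -- `fuel` bounds the number of vertices missing from `M`. If nothing can be attached although
    -- vertices are missing, the current edge is given up and `stuck` supplies a new one.
    spread : ∀ fuel {M} → Pancyclic M → 7 ≤ length M → Unique M → n ≤ fuel + length M → SpanningPancyclic
    spread zero {M} P _ _ n≤ = M , P , n≤
    spread (suc fuel) {M} P len U n≤ with attach M
    ... | inj₁ (d , d∉ , t) =
      spread fuel (addVertex P len (insertUnique d∉ U) t) (ℕ.m≤n⇒m≤1+n len) (insertUnique d∉ U)
        (subst (n ≤_) (sym (ℕ.+-suc fuel (length M))) n≤)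
    ... | inj₂ iso with outside M
    ...   | inj₁ o∉   = stuck iso U (ℕ.≤-trans (ℕ.m≤n+m 5 2) len) o∉
    ...   | inj₂ all∈ = M , P , covers⇒≤ all∈

    fromHeptagon : ∀ {M} → Cycle M → Unique M → length M ≡ 7 → SpanningPancyclic
    fromHeptagon {M} C U len = spread n (heptagon C U len) (ℕ.≤-reflexive (sym len)) U (ℕ.m≤m+n n (length M))

    fromHexagon : 7 ≤ n → ∀ {M} → Cycle M → Unique M → length M ≡ 6 → SpanningPancyclic
    fromHexagon 7≤n {M} C U len with attach M
    ... | inj₁ (d , d∉ , t) = fromHeptagon (addToHexagon C (insertUnique d∉ U) len t) (insertUnique d∉ U) (cong suc len)
    ... | inj₂ iso = stuck iso U (subst (5 ≤_) (sym len) (ℕ.m≤n+m 5 1)) (fresh M (subst (_< n) (sym len) 7≤n))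

    fromPentagon : 7 ≤ n → ∀ {M} → Cycle M → Unique M → length M ≡ 5 → SpanningPancyclic
    fromPentagon 7≤n {M} C U len with attach M
    ... | inj₁ (d , d∉ , t) = fromHexagon 7≤n (addToPentagon C (insertUnique d∉ U) len t) (insertUnique d∉ U) (cong suc len)
    ... | inj₂ iso = stuck iso U (ℕ.≤-reflexive (sym len)) (fresh M (subst (_< n) (sym len) (ℕ.≤-trans (ℕ.m≤n+m 6 1) 7≤n)))

  -- From a 4-cycle to a longer cycle

  Square : V → V → V → V → Set
  Square a b c e = (a ~ b × b ~ c × c ~ e × e ~ a) × Unique (a ∷ b ∷ c ∷ e ∷ [])

  HasSquare : Set
  HasSquare = ∃ λ a → ∃ λ b → ∃ λ c → ∃ λ e → Square a b c e

  rotate : ∀ {a b c e} → Square a b c e → Square b c e a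
  rotate {a} {b} {c} {e} ((ab , bc , ce , ea) , U) =
    (bc , ce , ea , ab) , Unique-resp-↭ (↭-sym (shift a (b ∷ c ∷ e ∷ []) [])) U

  flip : ∀ {a b c e} → Square a b c e → Square a e c b
  flip ((ab , bc , ce , ea) , (a≢b ∷ a≢c ∷ a≢e ∷ []) ∷ (b≢c ∷ b≢e ∷ []) ∷ (c≢e ∷ []) ∷ _) =
    (~-sym ea , ~-sym ce , ~-sym bc , ~-sym ab) ,
    (a≢e ∷ a≢c ∷ a≢b ∷ []) ∷ (c≢e ∘ sym ∷ b≢e ∘ sym ∷ []) ∷ (b≢c ∘ sym ∷ []) ∷ [] ∷ []

  -- Up to rotation and reflection, two vertices of a 4-cycle are consecutive (`inj₁`) or opposite
  -- (`inj₂`).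
  record Placed (x y : V) (M : List V) : Set where
    constructor placed
    field
      {z w} : V
      order : Square x y z w ⊎ Square x z y w
      perm  : x ∷ y ∷ z ∷ w ∷ [] ↭ M

  placeFirst : ∀ {a b c e y} → Square a b c e → y ∈ a ∷ b ∷ c ∷ e ∷ [] → a ≢ y → Placed a y (a ∷ b ∷ c ∷ e ∷ [])
  placeFirst sq (here refl) a≢y = contradiction refl a≢y
  placeFirst sq (there (here refl)) _ = placed (inj₁ sq) ↭-refl
  placeFirst sq (there (there (here refl))) _ = placed (inj₂ sq) (prep _ (swap _ _ ↭-refl))
  placeFirst {b = b} {c} {e} sq (there (there (there (here refl)))) _ =
    placed (inj₁ (flip sq)) (prep _ (↭-trans (shift b (e ∷ c ∷ []) []) (prep b (swap e c ↭-refl))))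

  rotate-↭ : ∀ {a b c e : V} → b ∷ c ∷ e ∷ a ∷ [] ↭ a ∷ b ∷ c ∷ e ∷ []
  rotate-↭ {a} {b} {c} {e} = shift a (b ∷ c ∷ e ∷ []) []

  Placed-rotate : ∀ {a b c e x y} → Placed x y (b ∷ c ∷ e ∷ a ∷ []) → Placed x y (a ∷ b ∷ c ∷ e ∷ [])
  Placed-rotate (placed o σ) = placed o (↭-trans σ rotate-↭)

  place : ∀ {a b c e x y} → Square a b c e → x ∈ a ∷ b ∷ c ∷ e ∷ [] → y ∈ a ∷ b ∷ c ∷ e ∷ [] → x ≢ y →
          Placed x y (a ∷ b ∷ c ∷ e ∷ [])
  place sq (here refl) y∈ x≢y = placeFirst sq y∈ x≢y
  place sq (there (here refl)) y∈ x≢y = Placed-rotate (placeFirst (rotate sq) (∈-resp-↭ (↭-sym rotate-↭) y∈) x≢y)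
  place sq (there (there (here refl))) y∈ x≢y =
    Placed-rotate (Placed-rotate (placeFirst (rotate (rotate sq)) (∈-resp-↭ (↭-sym (↭-trans rotate-↭ rotate-↭)) y∈) x≢y))
  place sq (there (there (there (here refl)))) y∈ x≢y =
    Placed-rotate (Placed-rotate (Placed-rotate (placeFirst (rotate (rotate (rotate sq)))
      (∈-resp-↭ (↭-sym (↭-trans rotate-↭ (↭-trans rotate-↭ rotate-↭))) y∈) x≢y)))

  module _ (conn : TwoConnected G) (7≤n : 7 ≤ n) where

    pentagonPath : ∀ {u v xs} → u ~ v → Path u xs v → Unique xs → length xs ≡ 5 → SpanningPancyclic
    pentagonPath uv p U len = fromPentagon conn 7≤n (_ , _ , uv , span p) U len

    hexagonPath : ∀ {u v xs} → u ~ v → Path u xs v → Unique xs → length xs ≡ 6 → SpanningPancyclic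
    hexagonPath uv p U len = fromHexagon conn 7≤n (_ , _ , uv , span p) U len

    -- Any edge among `d`, `z`, `w` yields a 5-cycle at once. Otherwise these three are independent,
    -- so a sixth vertex `f` misses at most one of them, and two neighbours of `f` among them are
    -- linked by a path through all five other vertices, closing a 6-cycle.
    opposite : ∀ {x z y w d} → Square x z y w → d ∉ x ∷ z ∷ y ∷ w ∷ [] → d ~ x → d ~ y → SpanningPancyclic
    opposite {x} {z} {y} {w} {d} ((xz , zy , yw , wx) , U) d∉ dx dy with z ~? w | d ~? z | d ~? w
    ... | yes zw | _ | _ = pentagonPath dy (dx ∷ xz ∷ zw ∷ ~-sym yw ∷ [ y ])
      (Unique-resp-↭ (prep d (prep x (prep z (swap y w ↭-refl)))) (insertUnique d∉ U)) refl
    ... | no _ | yes dz | _ = pentagonPath dx (dz ∷ zy ∷ yw ∷ wx ∷ [ x ])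
      (Unique-resp-↭ (prep d (↭-sym rotate-↭)) (insertUnique d∉ U)) refl
    ... | no _ | no _ | yes dw = pentagonPath dx (dw ∷ ~-sym yw ∷ ~-sym zy ∷ ~-sym xz ∷ [ x ])
      (Unique-resp-↭ (prep d (↭-trans (prep x (↭-sym (↭-reverse (z ∷ y ∷ w ∷ [])))) (↭-sym rotate-↭))) (insertUnique d∉ U)) refl
    ... | no ¬zw | no ¬dz | no ¬dw with fresh (d ∷ x ∷ z ∷ y ∷ w ∷ []) (ℕ.≤-trans (ℕ.m≤n+m 6 1) 7≤n)
    ...   | f , f∉ with insertUnique f∉ (insertUnique d∉ U)
    ...     | U′@((f≢d ∷ f≢x ∷ f≢z ∷ f≢y ∷ f≢w ∷ []) ∷ (d≢x ∷ d≢z ∷ d≢y ∷ d≢w ∷ []) ∷ (_ ∷ _ ∷ _ ∷ []) ∷ (_ ∷ z≢w ∷ []) ∷ _) =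
      sixth (f ~? d) (f ~? z)
      where
      open Reorder using (solve; _⊜_; _⊕_)
      sixth : Dec (f ~ d) → Dec (f ~ z) → SpanningPancyclic
      sixth (no ¬fd) _ with joins d≢z d≢w z≢w (f≢d ∘ sym) f≢z f≢w ¬dz ¬dw ¬zw (¬fd ∘ ~-sym)
      ... | fz , fw = hexagonPath fw (fz ∷ ~-sym xz ∷ ~-sym dx ∷ dy ∷ yw ∷ [ w ])
        (Unique-resp-↭ (prep f (solve 4 (λ d x z r → d ⊕ x ⊕ z ⊕ r ⊜ z ⊕ x ⊕ d ⊕ r) ↭-refl
                                  (d ∷ []) (x ∷ []) (z ∷ []) (y ∷ w ∷ []))) U′) refl
      sixth (yes fd) (yes fz) = hexagonPath fd (fz ∷ zy ∷ yw ∷ wx ∷ ~-sym dx ∷ [ d ])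
        (Unique-resp-↭ (prep f (solve 3 (λ d x r → d ⊕ x ⊕ r ⊜ r ⊕ x ⊕ d) ↭-refl
                                  (d ∷ []) (x ∷ []) (z ∷ y ∷ w ∷ []))) U′) refl
      sixth (yes fd) (no ¬fz) = hexagonPath fd (fw ∷ ~-sym yw ∷ ~-sym zy ∷ ~-sym xz ∷ ~-sym dx ∷ [ d ])
        (Unique-resp-↭ (prep f (↭-sym (↭-reverse (d ∷ x ∷ z ∷ y ∷ w ∷ [])))) U′) refl
        where
        fw : f ~ w
        fw = stable λ ¬fw → five z≢w (f≢z ∘ sym) (d≢z ∘ sym) (f≢w ∘ sym) (d≢w ∘ sym) f≢d
               ¬zw (¬fz ∘ ~-sym) (¬dz ∘ ~-sym) (¬fw ∘ ~-sym) (¬dw ∘ ~-sym)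

    -- An attachable vertex gives a longer cycle directly. An isolating 4-cycle is too short for
    -- `stuck`, but its other two vertices `z`, `w` are inner, so `q₁` and `q₂` are adjacent and a
    -- detour through them is available.
    fromSquare : ∀ {a b c e} → Square a b c e → SpanningPancyclic
    fromSquare {a} {b} {c} {e} sq@(_ , U@((a≢b ∷ _) ∷ _)) with attach (a ∷ b ∷ c ∷ e ∷ [])
    ... | inj₁ (d , d∉ , x , y , (x∈ , y∈) , x≢y , dx , dy) with place sq x∈ y∈ x≢y
    ...   | placed (inj₁ ((_ , yz , zw , wx) , U′)) σ =
      pentagonPath dx (dy ∷ yz ∷ zw ∷ wx ∷ [ x ])
        (Unique-resp-↭ (prep d (↭-sym rotate-↭)) (insertUnique (d∉ ∘ ∈-resp-↭ σ) U′)) refl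
    ...   | placed (inj₂ sq′) σ =
      opposite sq′ (d∉ ∘ ∈-resp-↭ (↭-trans (prep x (swap _ _ ↭-refl)) σ)) dx dy
    fromSquare {a} {b} {c} {e} sq@(_ , U@((a≢b ∷ _) ∷ _)) | inj₂ iso
      with bridges conn iso (here refl) (there (here refl)) a≢b
             (proj₂ (fresh (a ∷ b ∷ c ∷ e ∷ []) (ℕ.≤-trans (ℕ.m≤n+m 5 2) 7≤n)))
    ... | B with place sq (Bridges.p₁∈ B) (Bridges.p₂∈ B) (Bridges.p₁≢p₂ B)
    ...   | placed {z} {w} o σ = around o
      where
      open Bridges B
      open Bridged iso B
      ring : ∀ {xs} → (∀ {t} → t ∈ xs → t ∈ a ∷ b ∷ c ∷ e ∷ []) → Unique xs → Unique (q₂ ∷ q₁ ∷ xs)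
      ring sub U = insertUnique (λ { (here refl) → q₁≢q₂ refl ; (there q∈) → q₂∉ (sub q∈) }) (insertUnique (q₁∉ ∘ sub) U)
      -- The detour closes an arc of the square from `p₁` to `p₂`: the long arc through `w`, `z`
      -- when they are consecutive, which gives a 6-cycle, and the arc through `z` when they are
      -- opposite, which gives a 5-cycle.
      around : Square p₁ p₂ z w ⊎ Square p₁ z p₂ w → SpanningPancyclic
      around (inj₁ ((_ , p₂z , zw , wp₁) , U′@((p₁≢p₂ ∷ p₁≢z ∷ p₁≢w ∷ []) ∷ (p₂≢z ∷ p₂≢w ∷ []) ∷ (z≢w ∷ []) ∷ _))) =
        hexagonPath (~-sym p₂q₂)
          (~-sym (q₁q₂ (∈-resp-↭ σ (there (there (here refl))) , p₁≢z ∘ sym , p₂≢z ∘ sym)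
                       (∈-resp-↭ σ (there (there (there (here refl)))) , p₁≢w ∘ sym , p₂≢w ∘ sym) z≢w)
            ∷ ~-sym p₁q₁ ∷ ~-sym wp₁ ∷ ~-sym zw ∷ ~-sym p₂z ∷ [ p₂ ])
          (ring (∈-resp-↭ σ ∘ ∈-resp-↭ (prep p₁ (↭-reverse (p₂ ∷ z ∷ w ∷ []))))
                (Unique-resp-↭ (prep p₁ (↭-sym (↭-reverse (p₂ ∷ z ∷ w ∷ [])))) U′)) refl
      around (inj₂ ((p₁z , zp₂ , _) , ((p₁≢z ∷ p₁≢p₂ ∷ p₁≢w ∷ []) ∷ (z≢p₂ ∷ z≢w ∷ []) ∷ (p₂≢w ∷ []) ∷ _))) =
        pentagonPath (~-sym p₂q₂)
          (~-sym (q₁q₂ (∈-resp-↭ σ (there (there (here refl))) , p₁≢z ∘ sym , z≢p₂)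
                       (∈-resp-↭ σ (there (there (there (here refl)))) , p₁≢w ∘ sym , p₂≢w ∘ sym) z≢w)
            ∷ ~-sym p₁q₁ ∷ p₁z ∷ zp₂ ∷ [ p₂ ])
          (ring sub ((p₁≢z ∷ p₁≢p₂ ∷ []) ∷ (z≢p₂ ∷ []) ∷ [] ∷ [])) refl
        where
        sub : ∀ {t} → t ∈ p₁ ∷ z ∷ p₂ ∷ [] → t ∈ a ∷ b ∷ c ∷ e ∷ []
        sub (here refl)                 = p₁∈
        sub (there (here refl))         = ∈-resp-↭ σ (there (there (here refl)))
        sub (there (there (here refl))) = p₂∈

  -- Existence of a 4-cycle

  splitByNeighbour : ∀ v (xs : List V) → ∃ λ as → ∃ λ bs → xs ↭ as ++ bs × All (v ~_) as × All (v ≁_) bs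
  splitByNeighbour v [] = [] , [] , ↭-refl , [] , []
  splitByNeighbour v (x ∷ xs) with splitByNeighbour v xs | v ~? x
  ... | as , bs , σ , vas , ¬vbs | yes vx = x ∷ as , bs , prep x σ , vx ∷ vas , ¬vbs
  ... | as , bs , σ , vas , ¬vbs | no ¬vx = as , x ∷ bs , ↭-trans (prep x σ) (↭-sym (shift x as bs)) , vas , ¬vx ∷ ¬vbs

  foundSquare : ∀ {m} (ρ : Fin m → V) (ρ-inj : ∀ {i j} → ρ i ≡ ρ j → i ≡ j) →
                Soundness.Found G five ρ ρ-inj (3 ∷ []) → HasSquare
  foundSquare ρ ρ-inj (u , v , uv , (is , p , U , len) ∷ []) = fromPath uv p (Unique.map⁺ ρ-inj U) (trans (List.length-map ρ is) len)
    where
    fromPath : ∀ {u v xs} → u ~ v → Path u xs v → Unique xs → length xs ≡ 4 → HasSquare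
    fromPath uv (e₀ ∷ e₁ ∷ e₂ ∷ [ _ ]) U refl = _ , _ , _ , _ , (e₀ , e₁ , e₂ , ~-sym uv) , U
    fromPath _ (_ ∷ _ ∷ _ ∷ _ ∷ [ _ ]) _ ()
    fromPath _ (_ ∷ _ ∷ _ ∷ _ ∷ _ ∷ _) _ ()

  -- Among any seven vertices, the first has at least three neighbours or at least four
  -- non-neighbours in the other six; `starCert` and `fourCert` settle these cases.
  square : 7 ≤ n → HasSquare
  square 7≤n = fromSeven (tabulate λ i → inject≤ {7} i 7≤n) (Unique.tabulate⁺ (inject≤-injective 7≤n 7≤n _ _)) refl
    where
    fromStar : ∀ {v a b c} rest → v ~ a → v ~ b → v ~ c → Unique (v ∷ a ∷ b ∷ c ∷ rest) → length rest ≡ 3 →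
               HasSquare
    fromStar (_ ∷ _ ∷ _ ∷ []) va vb vc U refl =
      foundSquare (lookup _) (lookup-injective U)
        (Soundness.sound G five (lookup _) (lookup-injective U) starCert starValid [] (va ∷ vb ∷ vc ∷ []) [])
    fromFour : ∀ {v a b c e} → v ≁ a → v ≁ b → v ≁ c → v ≁ e → Unique (v ∷ a ∷ b ∷ c ∷ e ∷ []) →
               HasSquare
    fromFour va vb vc ve U =
      foundSquare (lookup _) (lookup-injective U)
        (Soundness.sound G five (lookup _) (lookup-injective U) fourCert fourValid [] [] (va ∷ vb ∷ vc ∷ ve ∷ []))
    fewNeighbours : ∀ {v} as {bs} → All (v ≁_) bs → Unique (v ∷ as ++ bs) → 4 ≤ length bs →
          HasSquare
    fewNeighbours {v} as {b₁ ∷ b₂ ∷ b₃ ∷ b₄ ∷ bs} (n₁ ∷ n₂ ∷ n₃ ∷ n₄ ∷ _) (v∉ ∷ U) _ =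
      fromFour n₁ n₂ n₃ n₄ (Unique-++⁻ˡ (v ∷ b₁ ∷ b₂ ∷ b₃ ∷ b₄ ∷ []) (All.++⁻ʳ as v∉ ∷ Unique-++⁻ʳ as U))
    fewNeighbours _ {_ ∷ []} _ _ (s≤s ())
    fewNeighbours _ {_ ∷ _ ∷ []} _ _ (s≤s (s≤s ()))
    fewNeighbours _ {_ ∷ _ ∷ _ ∷ []} _ _ (s≤s (s≤s (s≤s ())))
    fromSeven : ∀ xs → Unique xs → length xs ≡ 7 → HasSquare
    fromSeven (v ∷ xs) U len with splitByNeighbour v xs
    ... | as , bs , σ , vas , ¬vbs = byLength as vas (Unique-resp-↭ (prep v σ) U)
            (trans (sym (List.length-++ as)) (trans (sym (↭-length σ)) (cong pred len)))
      where
      byLength : ∀ as → All (v ~_) as → Unique (v ∷ as ++ bs) → length as + length bs ≡ 6 →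
                 HasSquare
      byLength [] _ U len = fewNeighbours [] ¬vbs U (subst (4 ≤_) (sym len) (ℕ.m≤n+m 4 2))
      byLength (a ∷ []) _ U len = fewNeighbours (a ∷ []) ¬vbs U (subst (4 ≤_) (sym (cong pred len)) (ℕ.m≤n+m 4 1))
      byLength (a ∷ b ∷ []) _ U len = fewNeighbours (a ∷ b ∷ []) ¬vbs U (subst (4 ≤_) (sym (cong (pred ∘ pred) len)) ℕ.≤-refl)
      byLength (a ∷ b ∷ c ∷ as) (va ∷ vb ∷ vc ∷ _) U len =
        fromStar (as ++ bs) va vb vc U (trans (List.length-++ as) (cong (pred ∘ pred ∘ pred) len))

  spanningPancyclic : 7 ≤ n → TwoConnected G → SpanningPancyclic
  spanningPancyclic 7≤n conn with square 7≤n
  ... | _ , _ , _ , _ , sq = fromSquare conn 7≤n sq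

  -- From paths with adjacent ends to cycles indexed by `Fin k`

  atLast : ∀ {u xs v} → Path u xs v → ∃ λ i → lookup xs i ≡ v × suc (toℕ i) ≡ length xs
  atLast [ v ] = zero , refl , refl
  atLast (_ ∷ p) with atLast p
  ... | i , at , eq = suc i , at , cong suc eq

  atZero : ∀ {u xs v} → Path u xs v → ∀ i → toℕ i ≡ 0 → lookup xs i ≡ u
  atZero [ _ ]   zero _ = refl
  atZero (_ ∷ _) zero _ = refl

  atSuc : ∀ {u xs v} → Path u xs v → ∀ i j → suc (toℕ i) ≡ toℕ j → lookup xs i ~ lookup xs j
  atSuc (e ∷ p) zero    (suc j) eq rewrite atZero p j (sym (cong pred eq)) = e
  atSuc (_ ∷ p) (suc i) (suc j) eq = atSuc p i j (cong pred eq)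
  atSuc [ _ ] zero zero ()

  edgeOnCycle : ∀ {u v xs} → u ~ v → Path u xs v → Unique xs → 3 ≤ length xs → EdgeOnCycle G u v (length xs)
  edgeOnCycle {u} {v} {xs} uv p U 3≤ with atLast p
  -- The edge `uv` is the closing step of the cycle, from the last position, where `v` stands, to
  -- position 0, where `u` stands; hence both second alternatives.
  ... | l , at , sucl≡ = lookup xs , (3≤ , lookup-injective U , adjacent) , l , first p , inj₂ (sucl≡ , first-zero p) ,
                         inj₂ (at , atZero p (first p) (first-zero p))
    where
    first : ∀ {u xs v} → Path u xs v → Fin (length xs)
    first [ _ ]   = zero
    first (_ ∷ _) = zero
    first-zero : ∀ {u xs v} (p : Path u xs v) → toℕ (first p) ≡ 0
    first-zero [ _ ]   = refl
    first-zero (_ ∷ _) = refl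
    adjacent : ∀ i j → Consec i j → lookup xs i ~ lookup xs j
    adjacent i j (inj₁ next) = atSuc p i j next
    adjacent i j (inj₂ (suci≡ , j≡0))
      rewrite Fin.toℕ-injective (ℕ.suc-injective (trans suci≡ (sym sucl≡))) | at | atZero p j j≡0 = ~-sym uv

theorem5 : (n : ℕ) → 7 ≤ n → (G : Graph n) → TwoConnected G → Is42Graph G →
    Σ (Fin n) λ u → Σ (Fin n) λ v → PancyclicEdge G u v
theorem5 n 7≤n G conn is42 with Assembly.spanningPancyclic G (Paths.is42⇒fiveFree G is42) 7≤n conn
-- `M` has at least `n` entries, so every `k` up to `n` is within the range of `path`.
... | M , P , n≤ = u , v , edge , λ k 3≤k k≤n → onCycle k 3≤k (path k 3≤k (ℕ.≤-trans k≤n n≤))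
  where
  open Assembly.Pancyclic P
  open Paths G using (Path)
  onCycle : ∀ k → 3 ≤ k → (∃ λ xs → Path u xs v × Unique xs × length xs ≡ k) → EdgeOnCycle G u v k
  onCycle _ 3≤k (xs , p , U , refl) = Assembly.edgeOnCycle G (Paths.is42⇒fiveFree G is42) edge p U 3≤k
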